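{- Let $P$ be a convex polygon which is not a parallelogram. Then the maximum number of (inclusion-wise) maximal cliques in an $n$-vertex graph in $P_{hom}$ is $\Omega(n^3)$ (as $n\to\infty$, with $P$ fixed).
   Context: All graphs are finite. A polygon is a closed convex polygon in $\mathbb{R}^2$. For a finite collection of sets, its intersection graph has one vertex for each member of the collection, and two distinct vertices are adjacent iff the corresponding sets have nonempty intersection. $P_{hom}$ is the class of intersection graphs of finite collections of sets homothetic to $P$, i.e. sets obtained from $P$ by (positive) scaling and/or translation. -}

module Defs where

open import Level using (0ℓ; suc)
open import Algebra.Bundles using (CommutativeRing)
import Algebra.Properties.Monoid.Sum as MonoidSum
open import Data.Bool.Base using (Bool; T)
open import Data.Bool.Properties using (T?)
open import Data.Fin.Base as Fin using (Fin)
import Data.Fin.Properties as Fin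
open import Data.Fin.Subset using (Subset; inside; outside; _∈_; _⊆_)
open import Data.Fin.Subset.Properties using (_∈?_; _⊆?_; anySubset?)
open import Data.List.Base using (List; []; _∷_; _++_; map; filter; length)
open import Data.Nat.Base as ℕ using (ℕ)
open import Data.Product.Base using (∃; ∃₂; Σ-syntax; _×_; _,_)
open import Data.Vec.Base using ([]; _∷_)
open import Function.Bundles using (_⇔_)
open import Relation.Binary.Core using (Rel)
import Relation.Binary.Construct.NonStrictToStrict as ToStrict
open import Relation.Binary.PropositionalEquality.Core using (_≡_; _≢_)
open import Relation.Binary.Structures using (IsTotalOrder)
open import Relation.Nullary.Decidable.Core using (Dec; ¬?; _→-dec_; _×-dec_; map′; decidable-stable)
open import Relation.Nullary.Negation.Core using (¬_)
open import Relation.Unary as U using (Pred; Satisfiable; _≐_; _≬_)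

-- The real numbers, as a Dedekind-complete totally ordered field.  This
-- characterises ℝ uniquely up to isomorphism; since _≤_ is total and suprema
-- of arbitrary predicates exist, these are the classical reals.

record RealNumbers : Set (suc 0ℓ) where
  field
    commutativeRing : CommutativeRing 0ℓ 0ℓ

  open CommutativeRing commutativeRing public

  infix 4 _≤_

  field
    0≉1          : ¬ 0# ≈ 1#
    inverse      : ∀ x → ¬ x ≈ 0# → ∃ λ y → x * y ≈ 1#
    _≤_          : Rel Carrier 0ℓ
    isTotalOrder : IsTotalOrder _≈_ _≤_
    +-monoˡ-≤    : ∀ z {x y} → x ≤ y → x + z ≤ y + z
    *-nonNeg     : ∀ {x y} → 0# ≤ x → 0# ≤ y → 0# ≤ x * y

  UpperBound : Pred Carrier 0ℓ → Pred Carrier 0ℓ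
  UpperBound S b = ∀ x → S x → x ≤ b

  field
    complete : ∀ (S : Pred Carrier 0ℓ) → Satisfiable S → Satisfiable (UpperBound S) →
               ∃ λ s → UpperBound S s × (∀ b → UpperBound S b → s ≤ b)

  open ToStrict _≈_ _≤_ public using (_<_)

  open MonoidSum +-monoid public using (sum)

-- Simple graphs with vertex set Fin n.

record Graph (n : ℕ) : Set where
  field
    adjacent : Fin n → Fin n → Bool

  infix 4 _~_

  _~_ : Rel (Fin n) 0ℓ
  i ~ j = T (adjacent i j)

  field
    ~-sym    : ∀ {i j} → i ~ j → j ~ i
    ~-irrefl : ∀ {i} → ¬ i ~ i

module _ {n : ℕ} (G : Graph n) where
  open Graph G

  IsClique : Pred (Subset n) 0ℓ
  IsClique S = ∀ i j → i ∈ S → j ∈ S → i ≢ j → i ~ j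

  IsMaximalClique : Pred (Subset n) 0ℓ
  IsMaximalClique S = IsClique S × (∀ S′ → IsClique S′ → S ⊆ S′ → S′ ⊆ S)

  isClique? : U.Decidable IsClique
  isClique? S = Fin.all? λ i → Fin.all? λ j →
    (i ∈? S) →-dec ((j ∈? S) →-dec (¬? (i Fin.≟ j) →-dec T? (adjacent i j)))

  isMaximalClique? : U.Decidable IsMaximalClique
  isMaximalClique? S = isClique? S ×-dec
    map′ (λ ¬∃ S′ c s → decidable-stable (S′ ⊆? S) λ ¬s →
            ¬∃ (S′ , c , (λ {x} → s {x}) , λ (s′ : S′ ⊆ S) → ¬s (λ {x} → s′ {x})))
         (λ max (S′ , c , s , ¬s) → ¬s (λ {x} → max S′ c (λ {y} → s {y}) {x}))
         (¬? (anySubset? λ S′ → isClique? S′ ×-dec ((S ⊆? S′) ×-dec ¬? (S′ ⊆? S))))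

subsets : ∀ n → List (Subset n)
subsets ℕ.zero    = [] ∷ []
subsets (ℕ.suc n) = map (outside ∷_) (subsets n) ++ map (inside ∷_) (subsets n)

numberOfMaximalCliques : ∀ {n} → Graph n → ℕ
numberOfMaximalCliques {n} G = length (filter (isMaximalClique? G) (subsets n))

IsMaximumMaximalCliques : (∀ {n} → Pred (Graph n) 0ℓ) → ℕ → ℕ → Set
IsMaximumMaximalCliques 𝒢 n m =
  (Σ[ G ∈ Graph n ] 𝒢 G × numberOfMaximalCliques G ≡ m) ×
  (∀ (G : Graph n) → 𝒢 G → numberOfMaximalCliques G ℕ.≤ m)

-- f ≥ c · g eventually, for some constant c > 0; here c = 1 / C.

infix 4 _∈Ω_

_∈Ω_ : (f g : ℕ → ℕ) → Set
f ∈Ω g = ∃₂ λ C N → 0 ℕ.< C × (∀ n → N ℕ.≤ n → g n ℕ.≤ C ℕ.* f n)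

module Plane (R : RealNumbers) where
  open RealNumbers R

  Point : Set
  Point = Carrier × Carrier

  infix  4 _≈ₚ_
  infixl 6 _⊕_ _⊖_
  infixr 7 _•_

  _≈ₚ_ : Rel Point 0ℓ
  (x , y) ≈ₚ (x′ , y′) = x ≈ x′ × y ≈ y′

  _⊕_ _⊖_ : Point → Point → Point
  (x , y) ⊕ (x′ , y′) = x + x′ , y + y′
  (x , y) ⊖ (x′ , y′) = x - x′ , y - y′

  _•_ : Carrier → Point → Point
  a • (x , y) = a * x , a * y

  cross : Point → Point → Carrier
  cross (x , y) (x′ , y′) = x * y′ - y * x′

  ConvexHull : ∀ {k} → (Fin k → Point) → Pred Point 0ℓ
  ConvexHull {k} v p = Σ[ w ∈ (Fin k → Carrier) ]
    (∀ i → 0# ≤ w i) × sum w ≈ 1# ×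
    p ≈ₚ (sum (λ i → w i * x (v i)) , sum (λ i → w i * y (v i)))
    where open import Data.Product.Base renaming (proj₁ to x; proj₂ to y)

  -- The closed region bounded by a convex polygon with k ≥ 3 vertices v 0, …,
  -- v (k - 1) in counterclockwise order: every triple i < j < l then turns
  -- strictly to the left, and conversely such points are the vertices of a
  -- (nondegenerate) convex polygon, in this cyclic order.

  IsConvexPolygon : Pred Point 0ℓ → Set
  IsConvexPolygon P = Σ[ k ∈ ℕ ] Σ[ v ∈ (Fin k → Point) ]
    3 ℕ.≤ k ×
    (∀ i j l → i Fin.< j → j Fin.< l → 0# < cross (v j ⊖ v i) (v l ⊖ v i)) ×
    P ≐ ConvexHull v

  IsParallelogram : Pred Point 0ℓ → Set
  IsParallelogram P = Σ[ a ∈ Point ] Σ[ u ∈ Point ] Σ[ v ∈ Point ]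
    (¬ cross u v ≈ 0#) ×
    P ≐ λ p → ∃₂ λ s t → (0# ≤ s × s ≤ 1#) × (0# ≤ t × t ≤ 1#) ×
                         p ≈ₚ a ⊕ s • u ⊕ t • v

  record Homothety : Set where
    field
      scale          : Carrier
      scale-positive : 0# < scale
      translation    : Point

  image : Homothety → Pred Point 0ℓ → Pred Point 0ℓ
  image h P q = ∃ λ p → P p × q ≈ₚ scale • p ⊕ translation
    where open Homothety h

  -- The n vertices correspond to n distinct sets homothetic to P.

  Hom : Pred Point 0ℓ → ∀ {n} → Pred (Graph n) 0ℓ
  Hom P {n} G = Σ[ h ∈ (Fin n → Homothety) ]
    (∀ i j → image (h i) P ≐ image (h j) P → i ≡ j) ×
    (∀ i j → i ≢ j → (i ~ j) ⇔ (image (h i) P ≬ image (h j) P))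
    where open Graph G

{-# OPTIONS --safe #-}

-- Translates P + a and P + b meet iff a - b lies in the symmetric convex body
-- K = P - P.  A polygon that is not a parallelogram has three pairwise
-- nonparallel sides; each gives an edge of K, with midpoint q d, d < 3.  The
-- points q d ± q e (d ≠ e) are interior to 2K, whereas κ q d ∈ K only for
-- |κ| ≤ 1.  Hence, for some c > 1/2, all translates of P by multiples σ q d with
-- |σ| ≤ c meet across different axes d, while on a common axis σ and σ′ meet iff
-- |σ - σ′| ≤ 1.  Taking (1 - t i) q d and - t i q d with 1/2 ≤ t 0 < t 1 < … < c
-- makes the graph on each axis the complement of a half graph (X i meets Y j iff
-- j ≤ i), which has linearly many maximal cliques, and the complete join of three
-- such graphs has cubically many.

module Submission where

open import Level using (0ℓ)
open import Algebra.Bundles using (CommutativeRing)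
import Algebra.Properties.Ring as RingProperties
import Algebra.Properties.Semiring.Mult.TCOptimised as Mult
import Algebra.Solver.Ring
open import Algebra.Solver.Ring.AlmostCommutativeRing using (fromCommutativeRing; _-Raw-AlmostCommutative⟶_)
open import Axiom.ExcludedMiddle using (ExcludedMiddle)
open import Data.Bool.Base using (Bool; true; false)
open import Data.Fin.Base as Fin using (Fin; zero; suc; toℕ; fromℕ; fromℕ<; combine; remQuot; finToFun; funToFin)
open import Data.Fin.Patterns
import Data.Fin.Properties as Fin
open import Data.Fin.Subset using (Subset; inside; outside; _∈_; _⊆_)
open import Data.Integer.Base as ℤ using (ℤ; +_; -[1+_])
import Data.Integer.Properties as ℤ
open import Data.List.Base as List using (List; length; lookup)
import Data.List.Membership.Propositional as List
import Data.List.Membership.Propositional.Properties as List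
import Data.List.Properties as List
import Data.List.Relation.Unary.Any as Any
import Data.List.Relation.Unary.Any.Properties as Any
open import Data.Maybe.Base as Maybe using (Maybe)
open import Data.Nat.Base as ℕ using (ℕ; zero; suc; _^_; z≤n; s≤s)
open import Data.Nat.DivMod using (_/_; _%_; _mod_; m≡m%n+[m/n]*n; [m+kn]%n≡m%n; m<n⇒m%n≡m; m%n<n;
  m<n⇒m/n≡0; m*n/n≡m; +-distrib-/-∣ʳ; m/n*n≤m; /-monoˡ-≤)
open import Data.Nat.Divisibility using (n∣m*n)
import Data.Nat.Properties as ℕ
open import Data.Nat.Solver using (module +-*-Solver)
open import Data.Product.Base using (Σ-syntax; ∃; ∃₂; _×_; _,_; proj₁; proj₂)
open import Data.Sum.Base using (inj₁; inj₂; [_,_]′)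
open import Data.Unit.Base using (⊤)
open import Data.Vec.Base using ([]; _∷_; tabulate)
import Data.Vec.Properties as Vec
open import Function.Base using (_∘_; _⟨_⟩_)
open import Function.Bundles using (_⇔_; mk⇔; Equivalence; Inverse)
open import Relation.Binary.Core using (Rel)
import Relation.Binary.Construct.NonStrictToStrict as ToStrict
open import Relation.Binary.Definitions using (tri<; tri≈; tri>)
open import Relation.Binary.PropositionalEquality as ≡ using (_≡_; _≢_; _≗_)
open import Relation.Binary.Structures using (IsTotalOrder)
open import Relation.Nullary.Decidable using (Dec; yes; no; does; isYes; toWitness; fromWitness; dec-true; dec⇒maybe)
open import Relation.Nullary.Negation.Core using (¬_; contradiction)
open import Relation.Unary using (Pred; _≐_; _≬_)
open import Defs

-- Room above ½ is what the geometry has to supply. An axis carries offsets `1 - t` and `- t`, so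
-- both lie within `c` only if `1 - c ≤ t ≤ c`: for `c = ½` the single value `t = ½` would remain,
-- whereas any `c > ½` leaves an interval that holds as many thresholds as wanted. A parallelogram
-- has sides in two directions only, hence offers just two axes and a quadratic count.
--
-- On one axis a threshold `a` gives the clique of all `X i` with `a ≤ i` and all `Y j` with
-- `j ≤ a`, and in the join the three thresholds are chosen independently. Each index uses six
-- labels, so `n` vertices leave `n / 6` thresholds per axis.
--
-- A second obstacle is that `Hom P` asks for distinct sets, not distinct translation vectors.
-- Instead of recovering the vector from the set, two translates are told apart by the translates of
-- `P` that meet them, which is again a question about `K`.

-- Counting maximal cliques in the join of three complements of half graphs.

module MaximalCliques where

  open import Data.Nat.Base using (_+_; _*_; _≤_; _<_)
  open import Relation.Binary.PropositionalEquality using (refl; cong; cong₂)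
  open +-*-Solver using (solve; _:=_; _:*_; _:^_)

  -- (d , true , i) and (d , false , i) stand for X i and Y i on the axis d.
  Label : Set
  Label = Fin 3 × Bool × ℕ

  Ordered : Bool × ℕ → Bool × ℕ → Set
  Ordered (true  , i) (false , j) = j ℕ.≤ i
  Ordered (false , i) (true  , j) = i ℕ.≤ j
  Ordered (true  , _) (true  , _) = ⊤
  Ordered (false , _) (false , _) = ⊤

  Compatible : Label → Label → Set
  Compatible (d , x) (e , y) = d ≡ e → Ordered x y

  -- Labels are numbered in blocks of six, one block per index, so that every `n` simply takes the
  -- first `n` labels. If 6 does not divide `n`, the incomplete last block has index `n / 6`, above
  -- all thresholds used later.
  decode : ℕ → Label
  decode k = let d , s = remQuot {3} 2 (k mod 6) in d , Inverse.to Fin.2↔Bool s , k / 6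

  encode : Label → ℕ
  encode (d , s , i) = toℕ (combine d (Inverse.from Fin.2↔Bool s)) + i * 6

  encode∘decode : ∀ k → encode (decode k) ≡ k
  encode∘decode k = begin
    toℕ (combine d (Inverse.from Fin.2↔Bool (Inverse.to Fin.2↔Bool s))) + k / 6 * 6
      ≡⟨ cong (λ s → toℕ (combine d s) + k / 6 * 6) (Inverse.strictlyInverseʳ Fin.2↔Bool s) ⟩
    toℕ (combine d s) + k / 6 * 6
      ≡⟨ cong (λ r → toℕ r + k / 6 * 6) (Fin.combine-remQuot {3} 2 (k mod 6)) ⟩
    toℕ (k mod 6) + k / 6 * 6
      ≡⟨ cong (_+ k / 6 * 6) (Fin.toℕ-fromℕ< (m%n<n k 6)) ⟩
    k % 6 + k / 6 * 6
      ≡⟨ m≡m%n+[m/n]*n k 6 ⟨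
    k ∎
    where
    open ≡.≡-Reasoning
    d = proj₁ (remQuot {3} 2 (k mod 6))
    s = proj₂ (remQuot {3} 2 (k mod 6))

  decode∘encode : ∀ u → decode (encode u) ≡ u
  decode∘encode (d , s , i) = cong₂ (λ (d , s) i → d , Inverse.to Fin.2↔Bool s , i)
    (≡.trans (cong (remQuot {3} 2) remainder) (Fin.remQuot-combine {3} d s′)) quotient
    ⟨ ≡.trans ⟩ cong (λ s → d , s , i) (Inverse.strictlyInverseˡ Fin.2↔Bool s)
    where
    s′ = Inverse.from Fin.2↔Bool s
    r = combine d s′
    remainder : (toℕ r + i * 6) mod 6 ≡ r
    remainder = Fin.toℕ-injective (≡.trans (Fin.toℕ-fromℕ< (m%n<n (toℕ r + i * 6) 6))
      (≡.trans ([m+kn]%n≡m%n (toℕ r) i 6) (m<n⇒m%n≡m (Fin.toℕ<n r))))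
    quotient : (toℕ r + i * 6) / 6 ≡ i
    quotient = ≡.trans (+-distrib-/-∣ʳ (toℕ r) (n∣m*n i))
      (cong₂ _+_ (m<n⇒m/n≡0 (Fin.toℕ<n r)) (m*n/n≡m i 6))

  -- Below `n / 6` the blocks are complete, so both labels at a threshold occur as vertices on each
  -- axis; maximality and distinctness of the cliques rest on these vertices.
  vertex : ∀ {n} (d : Fin 3) (s : Bool) {i} → i < n / 6 → ∃ λ (v : Fin n) → decode (toℕ v) ≡ (d , s , i)
  vertex {n} d s {i} i<n/6 = fromℕ< k<n , ≡.trans (cong decode (Fin.toℕ-fromℕ< k<n)) (decode∘encode (d , s , i))
    where
    k<n : encode (d , s , i) < n
    k<n = ℕ.<-≤-trans (ℕ.+-monoˡ-< (i * 6) (Fin.toℕ<n (combine d _))) (ℕ.≤-trans (ℕ.*-monoˡ-≤ 6 i<n/6) (m/n*n≤m n 6))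

  decode-injective : ∀ {k l} → decode k ≡ decode l → k ≡ l
  decode-injective {k} {l} eq = ≡.trans (≡.sym (encode∘decode k)) (≡.trans (cong encode eq) (encode∘decode l))

  subsets-complete : ∀ {n} (S : Subset n) → S List.∈ subsets n
  subsets-complete []           = Any.here refl
  subsets-complete (false ∷ S) = List.∈-++⁺ˡ (List.∈-map⁺ (outside ∷_) (subsets-complete S))
  subsets-complete {suc n} (true ∷ S) =
    List.∈-++⁺ʳ (List.map (outside ∷_) (subsets n)) (List.∈-map⁺ (inside ∷_) (subsets-complete S))

  injective-family-≤-length : ∀ {a} {A : Set a} {xs : List A} {k} (f : Fin k → A) →
    (∀ {i j} → f i ≡ f j → i ≡ j) → (∀ i → f i List.∈ xs) → k ≤ length xs
  injective-family-≤-length {xs = xs} f f-injective f∈xs = Fin.injective⇒≤ {f = λ i → Any.index (f∈xs i)} λ {i} {j} eq →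
    f-injective (≡.trans (Any.lookup-index (f∈xs i)) (≡.trans (cong (lookup xs) eq) (≡.sym (Any.lookup-index (f∈xs j)))))

  funToFin-cong : ∀ {m n} {f g : Fin m → Fin n} → f ≗ g → funToFin f ≡ funToFin g
  funToFin-cong {zero}  f≗g = refl
  funToFin-cong {suc m} f≗g = cong₂ combine (f≗g zero) (funToFin-cong (f≗g ∘ suc))

  module CliqueCount {n : ℕ} (G : Graph n)
    (adjacency : ∀ {u v} → u ≢ v → Graph._~_ G u v ⇔ Compatible (decode (toℕ u)) (decode (toℕ v)))
    where

    Threshold : Set
    Threshold = Fin 3 → Fin (n / 6)

    -- Both inequalities are weak, so `X` and `Y` at the threshold itself are chosen together.
    Chosen : Threshold → Pred Label 0ℓ
    Chosen a (d , true  , i) = toℕ (a d) ≤ i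
    Chosen a (d , false , i) = i ≤ toℕ (a d)

    chosen? : ∀ a u → Dec (Chosen a u)
    chosen? a (d , true  , i) = toℕ (a d) ℕ.≤? i
    chosen? a (d , false , i) = i ℕ.≤? toℕ (a d)

    clique : Threshold → Subset n
    clique a = tabulate λ v → does (chosen? a (decode (toℕ v)))

    clique⁺ : ∀ a {v} → Chosen a (decode (toℕ v)) → v ∈ clique a
    clique⁺ a {v} c = Vec.lookup⇒[]= v _ (≡.trans (Vec.lookup∘tabulate _ v) (dec-true (chosen? a _) c))

    clique⁻ : ∀ a {v} → v ∈ clique a → Chosen a (decode (toℕ v))
    clique⁻ a {v} v∈ with chosen? a (decode (toℕ v)) | ≡.trans (≡.sym (Vec.lookup∘tabulate (λ v → does (chosen? a (decode (toℕ v)))) v)) (Vec.[]=⇒lookup v∈)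
    ... | yes c | _ = c
    ... | no _ | ()

    Chosen-Compatible : ∀ a u v → Chosen a u → Chosen a v → Compatible u v
    Chosen-Compatible a (d , true  , i) (.d , false , j) aᵈ≤i j≤aᵈ refl = ℕ.≤-trans j≤aᵈ aᵈ≤i
    Chosen-Compatible a (d , false , i) (.d , true  , j) i≤aᵈ aᵈ≤j refl = ℕ.≤-trans i≤aᵈ aᵈ≤j
    Chosen-Compatible a (d , true  , i) (.d , true  , j) _ _ refl = _
    Chosen-Compatible a (d , false , i) (.d , false , j) _ _ refl = _

    isClique : ∀ a → IsClique G (clique a)
    isClique a u v u∈ v∈ u≢v =
      Equivalence.from (adjacency u≢v) (Chosen-Compatible a _ _ (clique⁻ a u∈) (clique⁻ a v∈))

    -- Adjacency to the chosen vertex of the opposite kind at the threshold of the same axis is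
    -- literally the condition for being chosen: `X i` meets `Y (a d)` only if `a d ≤ i`, and `Y i`
    -- meets `X (a d)` only if `i ≤ a d`.
    isMaximal : ∀ a S → IsClique G S → clique a ⊆ S → S ⊆ clique a
    isMaximal a S S-clique ⊆S {v} v∈S = clique⁺ a (chosen (decode (toℕ v)) refl)
      where
      against : ∀ s {d s′ i} → decode (toℕ v) ≡ (d , s′ , i) → s ≢ s′ → Chosen a (d , s , toℕ (a d)) →
                Compatible (d , s , toℕ (a d)) (d , s′ , i)
      against s {d} eq s≢s′ c with w , w≡ ← vertex {n} d s (Fin.toℕ<n (a d)) =
        ≡.subst₂ Compatible w≡ eq (Equivalence.to (adjacency w≢v)
          (S-clique w v (⊆S (clique⁺ a (≡.subst (Chosen a) (≡.sym w≡) c))) v∈S w≢v))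
        where
        w≢v : w ≢ v
        w≢v refl = s≢s′ (cong (proj₁ ∘ proj₂) (≡.trans (≡.sym w≡) eq))

      chosen : ∀ u → decode (toℕ v) ≡ u → Chosen a u
      chosen (d , true  , i) eq = against false eq (λ ()) ℕ.≤-refl refl
      chosen (d , false , i) eq = against true  eq (λ ()) ℕ.≤-refl refl

    -- The vertex `X (a d)` belongs to the clique of `a`; if it also belongs to that of `b`, then
    -- `b d ≤ a d`. Exchanging `a` and `b` gives equality.
    clique-injective : ∀ a b → clique a ≡ clique b → a ≗ b
    clique-injective a b eq d = Fin.toℕ-injective (ℕ.≤-antisym (≤-threshold b a (≡.sym eq)) (≤-threshold a b eq))
      where
      ≤-threshold : ∀ a b → clique a ≡ clique b → toℕ (b d) ≤ toℕ (a d)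
      ≤-threshold a b eq with w , w≡ ← vertex {n} d true (Fin.toℕ<n (a d)) =
        ≡.subst (Chosen b) w≡ (clique⁻ b (≡.subst (w ∈_) eq (clique⁺ a (≡.subst (Chosen a) (≡.sym w≡) ℕ.≤-refl))))

    [n/6]³≤numberOfMaximalCliques : (n / 6) ^ 3 ≤ numberOfMaximalCliques G
    [n/6]³≤numberOfMaximalCliques = injective-family-≤-length (clique ∘ finToFun)
      (λ {i} {j} eq → ≡.trans (≡.sym (Fin.funToFin-finToFin {3} {n / 6} i))
        (≡.trans (funToFin-cong (clique-injective _ _ eq)) (Fin.funToFin-finToFin {3} {n / 6} j)))
      (λ i → List.∈-filter⁺ (isMaximalClique? G) (subsets-complete _)
        (isClique (finToFun i) , λ S c s → isMaximal (finToFun i) S c s))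

  numberOfMaximalCliques-≤ : ∀ {n} (G : Graph n) → numberOfMaximalCliques G ≤ length (subsets n)
  numberOfMaximalCliques-≤ {n} G = List.length-filter (isMaximalClique? G) (subsets n)

  -- Being attained by a graph in `Hom P` is a statement about reals, so the search downwards from
  -- the bound decides it by excluded middle.
  bounded-maximum : ExcludedMiddle 0ℓ → (Q : Pred ℕ 0ℓ) → ∀ b → (∀ k → Q k → k ≤ b) → ∃ Q →
    ∃ λ m → Q m × (∀ k → Q k → k ≤ m)
  bounded-maximum em Q b Q≤b (k , q) with em {Q b}
  ... | yes qᵇ = b , qᵇ , Q≤b
  bounded-maximum em Q zero Q≤b (k , q) | no ¬q =
    contradiction (≡.subst Q (ℕ.n≤0⇒n≡0 (Q≤b k q)) q) ¬q
  bounded-maximum em Q (suc b) Q≤b ∃Q | no ¬q =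
    bounded-maximum em Q b (λ k q → ℕ.m<1+n⇒m≤n (ℕ.≤∧≢⇒< (Q≤b k q) λ { refl → ¬q q })) ∃Q

  -- The constant is 12³: the remainder is at most 6, and one more block of 6 is at most `n / 6 * 6`
  -- as soon as `n / 6` is positive.
  n³≤1728[n/6]³ : ∀ n → 6 ≤ n → n ^ 3 ≤ 1728 * (n / 6) ^ 3
  n³≤1728[n/6]³ n 6≤n = begin
    n ^ 3                  ≤⟨ ℕ.^-monoˡ-≤ 3 n≤12m ⟩
    (12 * (n / 6)) ^ 3     ≡⟨ solve 2 (λ k m → (k :* m) :^ 3 := k :^ 3 :* m :^ 3) refl 12 (n / 6) ⟩
    1728 * (n / 6) ^ 3     ∎
    where
    open ℕ.≤-Reasoning
    n≤12m : n ≤ 12 * (n / 6)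
    n≤12m = begin
      n                              ≡⟨ m≡m%n+[m/n]*n n 6 ⟩
      n % 6 + n / 6 * 6              ≤⟨ ℕ.+-monoˡ-≤ (n / 6 * 6) (ℕ.≤-trans (ℕ.<⇒≤ (m%n<n n 6)) (ℕ.*-monoˡ-≤ 6 (/-monoˡ-≤ 6 6≤n))) ⟩
      n / 6 * 6 + n / 6 * 6          ≡⟨ ℕ.*-distribˡ-+ (n / 6) 6 6 ⟨
      n / 6 * 12                     ≡⟨ ℕ.*-comm (n / 6) 12 ⟩
      12 * (n / 6)                   ∎

open MaximalCliques

-- A ring solver with integer coefficients.

module IntegerRingSolver {c ℓ} (R : CommutativeRing c ℓ) where

  open CommutativeRing R
  open RingProperties ring
  open Mult semiring using (×-homo-+; ×1-homo-*; 1+×) renaming (_×_ to _×′_)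
  open import Relation.Binary.Reasoning.Setoid setoid

  -- Cancelling terms requires coefficients with decidable equality, which integers have and
  -- abstract reals do not. The optimised multiple makes `1 ×′ 1#` reduce to `1#`, so that `:1`
  -- denotes `1#` by computation.
  fromℤ : ℤ → Carrier
  fromℤ (+ n)    = n ×′ 1#
  fromℤ -[1+ n ] = - (suc n ×′ 1#)

  fromℤ-⊖ : ∀ m n → fromℤ (m ℤ.⊖ n) ≈ m ×′ 1# - n ×′ 1#
  fromℤ-⊖ zero    zero    = sym (-‿inverseʳ 0#)
  fromℤ-⊖ zero    (suc n) = sym (+-identityˡ _)
  fromℤ-⊖ (suc m) zero    = sym (trans (+-congˡ -0#≈0#) (+-identityʳ _))
  fromℤ-⊖ (suc m) (suc n) = begin
    fromℤ (suc m ℤ.⊖ suc n)                  ≡⟨ ≡.cong fromℤ (ℤ.[1+m]⊖[1+n]≡m⊖n m n) ⟩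
    fromℤ (m ℤ.⊖ n)                          ≈⟨ fromℤ-⊖ m n ⟩
    m ×′ 1# - n ×′ 1#                      ≈⟨ +-congʳ (+-identityʳ _) ⟨
    m ×′ 1# + 0# - n ×′ 1#                 ≈⟨ +-congʳ (+-congˡ (-‿inverseʳ 1#)) ⟨
    m ×′ 1# + (1# - 1#) - n ×′ 1#          ≈⟨ +-congʳ (+-assoc _ _ _) ⟨
    m ×′ 1# + 1# - 1# - n ×′ 1#            ≈⟨ +-congʳ (+-congʳ (+-comm _ _)) ⟩
    1# + m ×′ 1# - 1# - n ×′ 1#            ≈⟨ +-assoc _ _ _ ⟩
    1# + m ×′ 1# + (- 1# - n ×′ 1#)        ≈⟨ +-congˡ (-‿+-comm _ _) ⟩
    1# + m ×′ 1# - (1# + n ×′ 1#)          ≈⟨ +-cong (1+× m 1#) (-‿cong (1+× n 1#)) ⟨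
    suc m ×′ 1# - suc n ×′ 1#              ∎

  fromℤ-neg : ∀ i → fromℤ (ℤ.- i) ≈ - fromℤ i
  fromℤ-neg (+ zero)  = sym -0#≈0#
  fromℤ-neg (+ suc n) = refl
  fromℤ-neg -[1+ n ]  = sym (-‿involutive _)

  fromℤ-+ : ∀ i j → fromℤ (i ℤ.+ j) ≈ fromℤ i + fromℤ j
  fromℤ-+ (+ m)    (+ n)    = ×-homo-+ 1# m n
  fromℤ-+ (+ m)    -[1+ n ] = fromℤ-⊖ m (suc n)
  fromℤ-+ -[1+ m ] (+ n)    = trans (fromℤ-⊖ n (suc m)) (+-comm _ _)
  fromℤ-+ -[1+ m ] -[1+ n ] = begin
    - (suc (suc (m ℕ.+ n)) ×′ 1#)            ≡⟨ ≡.cong (λ k → - (suc k ×′ 1#)) (Nat.+-suc m n) ⟨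
    - ((suc m ℕ.+ suc n) ×′ 1#)              ≈⟨ -‿cong (×-homo-+ 1# (suc m) (suc n)) ⟩
    - (suc m ×′ 1# + suc n ×′ 1#)            ≈⟨ -‿+-comm _ _ ⟨
    - (suc m ×′ 1#) + - (suc n ×′ 1#)        ∎
    where import Data.Nat.Properties as Nat

  fromℤ-pos-* : ∀ m j → fromℤ (+ m ℤ.* j) ≈ m ×′ 1# * fromℤ j
  fromℤ-pos-* m (+ n) = trans (reflexive (≡.cong fromℤ (≡.sym (ℤ.pos-* m n)))) (×1-homo-* m n)
  fromℤ-pos-* m -[1+ n ] = begin
    fromℤ (+ m ℤ.* -[1+ n ])          ≡⟨ ≡.cong fromℤ (ℤ.neg-distribʳ-* (+ m) (+ suc n)) ⟨
    fromℤ (ℤ.- (+ m ℤ.* + suc n))     ≈⟨ fromℤ-neg (+ m ℤ.* + suc n) ⟩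
    - fromℤ (+ m ℤ.* + suc n)         ≈⟨ -‿cong (fromℤ-pos-* m (+ suc n)) ⟩
    - (m ×′ 1# * suc n ×′ 1#)         ≈⟨ -‿distribʳ-* _ _ ⟩
    m ×′ 1# * - (suc n ×′ 1#)         ∎

  fromℤ-* : ∀ i j → fromℤ (i ℤ.* j) ≈ fromℤ i * fromℤ j
  fromℤ-* (+ m)    j = fromℤ-pos-* m j
  fromℤ-* -[1+ m ] j = begin
    fromℤ (-[1+ m ] ℤ.* j)            ≡⟨ ≡.cong fromℤ (ℤ.neg-distribˡ-* (+ suc m) j) ⟨
    fromℤ (ℤ.- (+ suc m ℤ.* j))       ≈⟨ fromℤ-neg (+ suc m ℤ.* j) ⟩
    - fromℤ (+ suc m ℤ.* j)           ≈⟨ -‿cong (fromℤ-pos-* (suc m) j) ⟩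
    - (suc m ×′ 1# * fromℤ j)         ≈⟨ -‿distribˡ-* _ _ ⟩
    - (suc m ×′ 1#) * fromℤ j         ∎

  fromℤ-homomorphism : ℤ.+-*-rawRing -Raw-AlmostCommutative⟶ fromCommutativeRing R
  fromℤ-homomorphism = record
    { ⟦_⟧    = fromℤ
    ; +-homo = fromℤ-+
    ; *-homo = fromℤ-*
    ; -‿homo = fromℤ-neg
    ; 0-homo = refl
    ; 1-homo = refl
    }

  fromℤ≟ : ∀ i j → Maybe (fromℤ i ≈ fromℤ j)
  fromℤ≟ i j = Maybe.map (reflexive ∘ ≡.cong fromℤ) (dec⇒maybe (i ℤ.≟ j))

  open Algebra.Solver.Ring ℤ.+-*-rawRing (fromCommutativeRing R) fromℤ-homomorphism
    fromℤ≟ public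
    using (Polynomial; solve; _:=_; _:+_; _:*_; _:-_; :-_; con)

  :0 :1 : ∀ {n} → Polynomial n
  :0 = con (+ 0)
  :1 = con (+ 1)

-- Order and estimates in the real field.

module OrderedField (R : RealNumbers) where

  open RealNumbers R public hiding (zero)
  open IsTotalOrder isTotalOrder public
    using (total; antisym)
    renaming (refl to ≤-refl; reflexive to ≤-reflexive; trans to ≤-trans;
              ≤-respˡ-≈ to ≤-respˡ; ≤-respʳ-≈ to ≤-respʳ)
  open IntegerRingSolver commutativeRing public

  0≤difference : ∀ {x y} → x ≤ y → 0# ≤ y - x
  0≤difference {x} {y} x≤y = ≤-respˡ (-‿inverseʳ x) (+-monoˡ-≤ (- x) x≤y)

  -- Splits an estimate into a ring identity, left to the solver, and a visibly nonnegative
  -- expression for the difference; most inequalities below are proved in this form.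
  ≤-via : ∀ {x y e} → 0# ≤ e → y - x ≈ e → x ≤ y
  ≤-via {x} {y} {e} 0≤e eq =
    ≤-respˡ (+-identityˡ x) (≤-respʳ
      (trans (+-congʳ (sym eq)) (solve 2 (λ x y → y :- x :+ x := y) refl x y))
      (+-monoˡ-≤ x 0≤e))

  +-nonNeg : ∀ {x y} → 0# ≤ x → 0# ≤ y → 0# ≤ x + y
  +-nonNeg {x} {y} 0≤x 0≤y = ≤-trans 0≤y (≤-respˡ (+-identityˡ y) (+-monoˡ-≤ y 0≤x))

  <⇒≤ : ∀ {x y} → x < y → x ≤ y
  <⇒≤ = proj₁

  <⇒≱ : ∀ {x y} → x < y → ¬ y ≤ x
  <⇒≱ = ToStrict.<⇒≱ _≈_ _≤_ antisym

  0<difference : ∀ {x y} → x < y → 0# < y - x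
  0<difference {x} {y} (x≤y , x≉y) = 0≤difference x≤y , λ eq → x≉y (sym (
    trans (solve 2 (λ x y → y := y :- x :+ x) refl x y)
          (trans (+-congʳ (sym eq)) (+-identityˡ x))))

  <-via : ∀ {x y e} → 0# < e → y - x ≈ e → x < y
  <-via {x} (0≤e , 0≉e) eq = ≤-via 0≤e eq ,
    λ x≈y → 0≉e (trans (sym (-‿inverseʳ x)) (trans (+-congʳ x≈y) eq))

  0<-resp : ∀ {x y} → x ≈ y → 0# < x → 0# < y
  0<-resp x≈y (0≤x , 0≉x) = ≤-respʳ x≈y 0≤x , λ eq → 0≉x (trans eq (sym x≈y))

  0<⇒≉0 : ∀ {x} → 0# < x → ¬ x ≈ 0#
  0<⇒≉0 (_ , 0≉x) eq = 0≉x (sym eq)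

  <-≤-trans : ∀ {x y z} → x < y → y ≤ z → x < z
  <-≤-trans = ToStrict.<-≤-trans _≈_ _≤_ sym ≤-trans antisym ≤-respʳ

  +-pos-nonNeg : ∀ {x y} → 0# < x → 0# ≤ y → 0# < x + y
  +-pos-nonNeg {x} {y} 0<x 0≤y =
    <-≤-trans 0<x (≤-via 0≤y (solve 2 (λ x y → x :+ y :- x := y) refl x y))

  *-cancelˡ-0 : ∀ {x y} → ¬ x ≈ 0# → x * y ≈ 0# → y ≈ 0#
  *-cancelˡ-0 {x} {y} x≉0 xy≈0 with x⁻¹ , xx⁻¹≈1 ← inverse x x≉0 =
    trans (sym (*-identityˡ y)) (trans (*-congʳ (sym xx⁻¹≈1))
      (trans (solve 3 (λ x x⁻¹ y → x :* x⁻¹ :* y := x⁻¹ :* (x :* y)) refl x x⁻¹ y)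
        (trans (*-congˡ xy≈0) (zeroʳ x⁻¹))))

  *-pos : ∀ {x y} → 0# < x → 0# < y → 0# < x * y
  *-pos 0<x 0<y = *-nonNeg (<⇒≤ 0<x) (<⇒≤ 0<y) ,
    λ eq → 0<⇒≉0 0<y (*-cancelˡ-0 (0<⇒≉0 0<x) (sym eq))

  neg-nonNeg : ∀ {x} → x ≤ 0# → 0# ≤ - x
  neg-nonNeg {x} x≤0 = ≤-respʳ (+-identityˡ (- x)) (0≤difference x≤0)

  *-cancelˡ-pos : ∀ {x y} → 0# < x → 0# < x * y → 0# < y
  *-cancelˡ-pos {x} {y} 0<x 0<xy with total 0# y
  ... | inj₁ 0≤y = 0≤y , λ eq → 0<⇒≉0 0<xy (trans (*-congˡ (sym eq)) (zeroʳ x))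
  ... | inj₂ y≤0 = contradiction
    (≤-via (*-nonNeg (<⇒≤ 0<x) (neg-nonNeg y≤0))
           (solve 2 (λ x y → :0 :- x :* y := x :* (:- y)) refl x y))
    (<⇒≱ 0<xy)

  *-cancelˡ-nonNeg : ∀ {x y} → 0# < x → 0# ≤ x * y → 0# ≤ y
  *-cancelˡ-nonNeg {x} {y} 0<x 0≤xy with total 0# y
  ... | inj₁ 0≤y = 0≤y
  ... | inj₂ y≤0 = ≤-reflexive (sym (*-cancelˡ-0 (0<⇒≉0 0<x) (antisym
    (≤-via (*-nonNeg (<⇒≤ 0<x) (neg-nonNeg y≤0))
           (solve 2 (λ x y → :0 :- x :* y := x :* (:- y)) refl x y)) 0≤xy)))

  0<1 : 0# < 1#
  0<1 with total 0# 1#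
  ... | inj₁ 0≤1 = 0≤1 , 0≉1
  ... | inj₂ 1≤0 = ≤-respʳ (solve 0 (:- :1 :* :- :1 := :1) refl)
    (*-nonNeg (neg-nonNeg 1≤0) (neg-nonNeg 1≤0)) , 0≉1

  reciprocal : ∀ {x} → 0# < x → ∃ λ y → 0# < y × x * y ≈ 1#
  reciprocal 0<x with y , xy≈1 ← inverse _ (0<⇒≉0 0<x) =
    y , *-cancelˡ-pos 0<x (0<-resp (sym xy≈1) 0<1) , xy≈1

  abstract
    ½ : Carrier
    ½ = proj₁ (reciprocal (+-pos-nonNeg 0<1 (<⇒≤ 0<1)))

    0<½ : 0# < ½
    0<½ = proj₁ (proj₂ (reciprocal (+-pos-nonNeg 0<1 (<⇒≤ 0<1))))

    -- Identities involving ½ are proved by treating ½ as a variable and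
    -- rewriting with this equation.
    2½≈1 : (1# + 1#) * ½ ≈ 1#
    2½≈1 = proj₂ (proj₂ (reciprocal (+-pos-nonNeg 0<1 (<⇒≤ 0<1))))

  Within : Carrier → Pred Carrier 0ℓ
  Within r x = - r ≤ x × x ≤ r

  Within-mono : ∀ {r s x} → r ≤ s → Within r x → Within s x
  Within-mono {r} {s} r≤s (-r≤x , x≤r) =
    ≤-trans (≤-via (0≤difference r≤s) (solve 2 (λ r s → :- r :- :- s := s :- r) refl r s)) -r≤x ,
    ≤-trans x≤r r≤s

  Within-neg : ∀ {r x} → Within r x → Within r (- x)
  Within-neg {r} {x} (-r≤x , x≤r) =
    ≤-via (0≤difference x≤r) (solve 2 (λ r x → :- x :- :- r := r :- x) refl r x) ,
    ≤-via (0≤difference -r≤x) (solve 2 (λ r x → r :- :- x := x :- :- r) refl r x)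

  Within-scale : ∀ {r x k} → 0# ≤ k → Within r x → Within (k * r) (k * x)
  Within-scale {r} {x} {k} 0≤k (-r≤x , x≤r) =
    ≤-via (*-nonNeg 0≤k (0≤difference -r≤x))
          (solve 3 (λ r x k → k :* x :- :- (k :* r) := k :* (x :- :- r)) refl r x k) ,
    ≤-via (*-nonNeg 0≤k (0≤difference x≤r))
          (solve 3 (λ r x k → k :* r :- k :* x := k :* (r :- x)) refl r x k)

  Within-resp : ∀ {r s x y} → r ≈ s → x ≈ y → Within r x → Within s y
  Within-resp r≈s x≈y (lo , hi) =
    ≤-respʳ x≈y (≤-respˡ (-‿cong r≈s) lo) , ≤-respʳ r≈s (≤-respˡ x≈y hi)

  bounded : ∀ x → ∃ λ r → 1# ≤ r × Within r x
  bounded x with total 0# x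
  ... | inj₁ 0≤x = 1# + x ,
    ≤-via 0≤x (solve 1 (λ x → :1 :+ x :- :1 := x) refl x) ,
    ≤-via (+-nonNeg (<⇒≤ 0<1) (+-nonNeg 0≤x 0≤x)) (solve 1 (λ x → x :- :- (:1 :+ x) := :1 :+ (x :+ x)) refl x) ,
    ≤-via (<⇒≤ 0<1) (solve 1 (λ x → :1 :+ x :- x := :1) refl x)
  ... | inj₂ x≤0 = 1# - x ,
    ≤-via (neg-nonNeg x≤0) (solve 1 (λ x → :1 :- x :- :1 := :- x) refl x) ,
    ≤-via (<⇒≤ 0<1) (solve 1 (λ x → x :- :- (:1 :- x) := :1) refl x) ,
    ≤-via (+-nonNeg (<⇒≤ 0<1) (+-nonNeg (neg-nonNeg x≤0) (neg-nonNeg x≤0)))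
          (solve 1 (λ x → :1 :- x :- x := :1 :+ (:- x :+ :- x)) refl x)

  -- Meant for the coordinates of a point in the basis of two edge directions: a common factor
  -- brings both into the range in which one stays on the edges.
  common-scale : ∀ x y → ∃ λ k → 0# < k × Within 1# (k * x) × Within 1# (k * y)
  common-scale x y
    with r , 1≤r , x∈ ← bounded x
    with s , 1≤s , y∈ ← bounded y
    with k , 0<k , eq ← reciprocal (<-≤-trans 0<1
           (≤-trans 1≤r (≤-via (≤-trans (<⇒≤ 0<1) 1≤s)
             (solve 2 (λ r s → r :+ s :- r := s) refl r s))))
    = k , 0<k ,
      Within-resp (trans (*-comm k (r + s)) eq) refl (Within-scale (<⇒≤ 0<k) (Within-mono
        (≤-via (≤-trans (<⇒≤ 0<1) 1≤s) (solve 2 (λ r s → r :+ s :- r := s) refl r s)) x∈)) ,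
      Within-resp (trans (*-comm k (r + s)) eq) refl (Within-scale (<⇒≤ 0<k) (Within-mono
        (≤-via (≤-trans (<⇒≤ 0<1) 1≤r) (solve 2 (λ r s → r :+ s :- s := r) refl r s)) y∈))

  unscale : ∀ {c x} → 0# < c → Within c x → ∃ λ a → Within 1# a × c * a ≈ x
  unscale {c} {x} 0<c x∈ with k , 0<k , ck≈1 ← reciprocal 0<c =
    k * x , Within-resp (trans (*-comm k c) ck≈1) refl (Within-scale (<⇒≤ 0<k) x∈) ,
    trans (sym (*-assoc c k x)) (trans (*-congʳ ck≈1) (*-identityˡ x))

  -- Common witness above b for finitely many downward closed predicates.
  uniform-bound : ∀ {n b} → b < 1# → (Q : Fin n → Pred Carrier 0ℓ) →
    (∀ i {c c′} → c′ ≤ c → Q i c → Q i c′) →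
    (∀ i → ∃ λ c → b < c × Q i c) →
    ∃ λ c → b < c × c ≤ 1# × (∀ i → Q i c)
  uniform-bound {zero}  b<1 Q down each = 1# , b<1 , ≤-refl , λ ()
  uniform-bound {suc n} b<1 Q down each
    with c₀ , b<c₀ , q₀ ← each zero
    with c , b<c , c≤1 , q ← uniform-bound b<1 (λ i → Q (suc i)) (λ i → down (suc i)) (λ i → each (suc i))
    with total c₀ c
  ... | inj₁ c₀≤c = c₀ , b<c₀ , ≤-trans c₀≤c c≤1 ,
                    λ { zero → q₀ ; (suc i) → down (suc i) c₀≤c (q i) }
  ... | inj₂ c≤c₀ = c , b<c , c≤1 , λ { zero → down zero c≤c₀ q₀ ; (suc i) → q i }

  maximum : ∀ {n} (f : Fin (suc n) → Carrier) → ∃ λ i → ∀ j → f j ≤ f i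
  maximum {zero}  f = zero , λ { zero → ≤-refl }
  maximum {suc n} f with i , max ← maximum (λ j → f (suc j)) with total (f zero) (f (suc i))
  ... | inj₁ f₀≤ = suc i , λ { zero → f₀≤ ; (suc j) → max j }
  ... | inj₂ ≤f₀ = zero , λ { zero → ≤-refl ; (suc j) → ≤-trans (max j) ≤f₀ }

-- Vector algebra in the plane.

module PlaneAlgebra (R : RealNumbers) where

  open OrderedField R public
  open Plane R public

  -- To the solver `½` is a variable, so identities are stated with a spare factor `(1# + 1#) * ½`,
  -- which is removed here.
  ½-elim : ∀ {x y} → y ≈ (1# + 1#) * ½ * x → x ≈ y
  ½-elim {x} eq = trans (sym (*-identityˡ x)) (trans (*-congʳ (sym 2½≈1)) (sym eq))

  ≈ₚ-refl : ∀ {p} → p ≈ₚ p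
  ≈ₚ-refl = refl , refl

  ≈ₚ-sym : ∀ {p q} → p ≈ₚ q → q ≈ₚ p
  ≈ₚ-sym (a , b) = sym a , sym b

  ≈ₚ-trans : ∀ {p q r} → p ≈ₚ q → q ≈ₚ r → p ≈ₚ r
  ≈ₚ-trans (a , b) (c , d) = trans a c , trans b d

  infix 8 ⊝_
  ⊝_ : Point → Point
  ⊝ (x , y) = - x , - y

  0ₚ : Point
  0ₚ = 0# , 0#

  cross-cong : ∀ {p p′ q q′} → p ≈ₚ p′ → q ≈ₚ q′ → cross p q ≈ cross p′ q′
  cross-cong (a , b) (c , d) = +-cong (*-cong a d) (-‿cong (*-cong b c))

  cross-• : ∀ p a q → cross p (a • q) ≈ a * cross p q
  cross-• (x , y) a (x′ , y′) =
    solve 5 (λ x y a x′ y′ → x :* (a :* y′) :- y :* (a :* x′) := a :* (x :* y′ :- y :* x′)) refl x y a x′ y′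

  record IsConvexSet (K : Pred Point 0ℓ) : Set where
    field
      resp   : ∀ {p q} → p ≈ₚ q → K p → K q
      convex : ∀ {p q s t} → K p → K q → 0# ≤ s → 0# ≤ t → s + t ≈ 1# → K (s • p ⊕ t • q)

  IsSymmetric : Pred Point 0ℓ → Set
  IsSymmetric K = ∀ p → K p → K (⊝ p)

-- Boxes inside a symmetric convex set.

module Octahedron (R : RealNumbers) (K : Pred (Plane.Point R) 0ℓ)
  (K-isConvex : PlaneAlgebra.IsConvexSet R K) (K-neg : PlaneAlgebra.IsSymmetric R K)
  where

  open PlaneAlgebra R
  open IsConvexSet K-isConvex renaming (resp to K-resp; convex to K-convex)

  segment : ∀ {u w σ} → K (u ⊕ w) → K (u ⊖ w) → Within 1# σ → K (u ⊕ σ • w)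
  segment {u} {w} {σ} K₊ K₋ (lo , hi) = K-resp
    (sym (½-elim (coordinate (proj₁ u) (proj₁ w))) , sym (½-elim (coordinate (proj₂ u) (proj₂ w))))
    (K-convex K₊ K₋
      (*-nonNeg (<⇒≤ 0<½) (≤-respʳ (solve 1 (λ σ → σ :- :- :1 := :1 :+ σ) refl σ) (0≤difference lo)))
      (*-nonNeg (<⇒≤ 0<½) (0≤difference hi))
      (sym (½-elim (solve 2 (λ h σ → h :* (:1 :+ σ) :+ h :* (:1 :- σ) := (:1 :+ :1) :* h :* :1) refl ½ σ))))
    where
    coordinate : ∀ u w → ½ * (1# + σ) * (u + w) + ½ * (1# - σ) * (u - w) ≈ (1# + 1#) * ½ * (u + σ * w)
    coordinate u w = solve 4 (λ h σ u w →
      h :* (:1 :+ σ) :* (u :+ w) :+ h :* (:1 :- σ) :* (u :- w) := (:1 :+ :1) :* h :* (u :+ σ :* w))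
      refl ½ σ u w

  shrink : ∀ {q κ} → K q → Within 1# κ → K (κ • q)
  shrink {q} {κ} Kq κ∈ = K-resp (+-identityˡ _ , +-identityˡ _)
    (segment {0ₚ} (K-resp (sym (+-identityˡ _) , sym (+-identityˡ _)) Kq)
                  (K-resp (sym (+-identityˡ _) , sym (+-identityˡ _)) (K-neg _ Kq)) κ∈)

  -- Boxes use only that `K` contains this segment; that it lies on the boundary enters later,
  -- through `supporting`.
  record Edge : Set where
    field
      centre   : Point
      half     : Point
      end₊     : K (centre ⊕ half)
      end₋     : K (centre ⊖ half)

  open Edge

  -- Turns the midpoint of two edge centres into half the difference of the centres. Keeping `half`
  -- makes the same nonparallelism assumption apply to both.
  opposite : Edge → Edge
  opposite E = record
    { centre = ⊝ centre E
    ; half   = half E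
    ; end₊   = K-resp (eq₋ _ _ , eq₋ _ _) (K-neg _ (end₋ E))
    ; end₋   = K-resp (eq₊ _ _ , eq₊ _ _) (K-neg _ (end₊ E))
    }
    where
    eq₋ : ∀ q f → - (q - f) ≈ - q + f
    eq₋ = solve 2 (λ q f → :- (q :- f) := :- q :+ f) refl
    eq₊ : ∀ q f → - (q + f) ≈ - q - f
    eq₊ = solve 2 (λ q f → :- (q :+ f) := :- q :- f) refl

  cramer : ∀ {p u v δ} → cross u v * δ ≈ 1# →
    (δ * cross p v) • u ⊕ (δ * cross u p) • v ≈ₚ p
  cramer {p₁ , p₂} {u₁ , u₂} {v₁ , v₂} {δ} eq =
    trans (solve 7 (λ p₁ p₂ u₁ u₂ v₁ v₂ δ →
        δ :* (p₁ :* v₂ :- p₂ :* v₁) :* u₁ :+ δ :* (u₁ :* p₂ :- u₂ :* p₁) :* v₁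
        := (u₁ :* v₂ :- u₂ :* v₁) :* δ :* p₁) refl p₁ p₂ u₁ u₂ v₁ v₂ δ)
      (trans (*-congʳ eq) (*-identityˡ p₁)) ,
    trans (solve 7 (λ p₁ p₂ u₁ u₂ v₁ v₂ δ →
        δ :* (p₁ :* v₂ :- p₂ :* v₁) :* u₂ :+ δ :* (u₁ :* p₂ :- u₂ :* p₁) :* v₂
        := (u₁ :* v₂ :- u₂ :* v₁) :* δ :* p₂) refl p₁ p₂ u₁ u₂ v₁ v₂ δ)
      (trans (*-congʳ eq) (*-identityˡ p₂))

  -- The midpoints of two nonparallel edges are the centre of a parallelogram
  -- spanned by these edges, so that their own midpoint is interior to K.
  midpoint-interior : ∀ (E E′ : Edge) → ¬ cross (half E) (half E′) ≈ 0# →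
    ∃ λ c → ½ < c × (∀ {κ} → Within c κ → K (κ • (centre E ⊕ centre E′)))
  midpoint-interior E E′ nonparallel =
    let δ , Δδ≈1 = inverse _ nonparallel
        p = centre E ⊕ centre E′
        k , 0<k , x∈ , y∈ = common-scale (δ * cross p (half E′)) (δ * cross (half E) p)
        x≈ , y≈ = cramer {p} {half E} {half E′} Δδ≈1
    in expand 0<k x∈ y∈ (x≈ , y≈)
    where
    expand : ∀ {k x y} → 0# < k → Within 1# (k * x) → Within 1# (k * y) →
      x • half E ⊕ y • half E′ ≈ₚ centre E ⊕ centre E′ →
      ∃ λ c → ½ < c × (∀ {κ} → Within c κ → K (κ • (centre E ⊕ centre E′)))
    expand {k} {x} {y} 0<k x∈ y∈ (eq₁ , eq₂) = c , ½<c , λ κ∈ →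
      let a , a∈ , ca≈κ = unscale (<-≤-trans 0<½ (<⇒≤ ½<c)) κ∈ in
      K-resp (rescale a ca≈κ _ , rescale a ca≈κ _) (shrink corner a∈)
      where
      -- Sliding the two centres along their edges by `k * x` and `k * y` stays in `K`. The average
      -- of the new points is half of `(q + q′) + k (x f + y f′)`, that is, `½ (1 + k) (q + q′)`.
      c = ½ * (1# + k)

      ½<c : ½ < c
      ½<c = <-via (*-pos 0<½ 0<k) (solve 2 (λ h k → h :* (:1 :+ k) :- h := h :* k) refl ½ k)

      rescale : ∀ a {κ} → c * a ≈ κ → ∀ x → a * (c * x) ≈ κ * x
      rescale a eq x = trans (solve 3 (λ a c x → a :* (c :* x) := c :* a :* x) refl a c x) (*-congʳ eq)

      coordinate : ∀ {q f q′ f′} → x * f + y * f′ ≈ q + q′ →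
        ½ * (q + k * x * f) + ½ * (q′ + k * y * f′) ≈ c * (q + q′)
      coordinate {q} {f} {q′} {f′} eq = trans
        (solve 8 (λ h k x y q f q′ f′ →
          h :* (q :+ k :* x :* f) :+ h :* (q′ :+ k :* y :* f′)
          := h :* (q :+ q′ :+ k :* (x :* f :+ y :* f′))) refl ½ k x y q f q′ f′)
        (trans (*-congˡ (+-congˡ (*-congˡ eq)))
          (solve 4 (λ h k q q′ → h :* (q :+ q′ :+ k :* (q :+ q′)) := h :* (:1 :+ k) :* (q :+ q′))
            refl ½ k q q′))

      corner : K (c • (centre E ⊕ centre E′))
      corner = K-resp (coordinate eq₁ , coordinate eq₂)
        (K-convex (segment (end₊ E) (end₋ E) x∈) (segment (end₊ E′) (end₋ E′) y∈)
          (<⇒≤ 0<½) (<⇒≤ 0<½)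
          (sym (½-elim (solve 1 (λ h → h :+ h := (:1 :+ :1) :* h :* :1) refl ½))))

  Box : Point → Point → Pred Carrier 0ℓ
  Box q q′ c = ∀ α β → Within c α → Within c β → K (α • q ⊕ β • q′)

  Box-mono : ∀ {q q′ c c′} → c′ ≤ c → Box q q′ c → Box q q′ c′
  Box-mono c′≤c box α β α∈ β∈ = box α β (Within-mono c′≤c α∈) (Within-mono c′≤c β∈)

  -- The four corners are multiples by `c` and `- c` of the sum and the difference of `q` and `q′`.
  -- Convexity fills two opposite sides, and then the segments joining them.
  box-from-corners : ∀ {q q′ c} → 0# < c →
    (∀ {κ} → Within c κ → K (κ • (q ⊕ q′))) →
    (∀ {κ} → Within c κ → K (κ • (q ⊕ ⊝ q′))) →
    Box q q′ c
  box-from-corners {q} {q′} {c} 0<c K₊ K₋ α β α∈ β∈ =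
    fill (unscale 0<c α∈) (unscale 0<c β∈)
    where
    c∈ : Within c c
    c∈ = ≤-via (+-nonNeg (<⇒≤ 0<c) (<⇒≤ 0<c)) (solve 1 (λ c → c :- :- c := c :+ c) refl c) , ≤-refl

    distribute : ∀ c x y → c * (x + y) ≈ c * x + c * y
    distribute = distribˡ
    distribute-neg : ∀ c x y → c * (x + - y) ≈ c * x - c * y
    distribute-neg = solve 3 (λ c x y → c :* (x :+ :- y) := c :* x :- c :* y) refl
    neg-distribute : ∀ c x y → (- c) * (x + - y) ≈ - (c * x) + c * y
    neg-distribute = solve 3 (λ c x y → (:- c) :* (x :+ :- y) := :- (c :* x) :+ c :* y) refl
    neg-distribute-neg : ∀ c x y → (- c) * (x + y) ≈ - (c * x) - c * y
    neg-distribute-neg = solve 3 (λ c x y → (:- c) :* (x :+ y) := :- (c :* x) :- c :* y) refl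

    right-side : ∀ {b} → Within 1# b → K (c • q ⊕ b • c • q′)
    right-side = segment (K-resp (distribute c _ _ , distribute c _ _) (K₊ c∈))
                         (K-resp (distribute-neg c _ _ , distribute-neg c _ _) (K₋ c∈))

    left-side : ∀ {b} → Within 1# b → K (⊝ (c • q) ⊕ b • c • q′)
    left-side = segment (K-resp (neg-distribute c _ _ , neg-distribute c _ _) (K₋ (Within-neg c∈)))
                        (K-resp (neg-distribute-neg c _ _ , neg-distribute-neg c _ _) (K₊ (Within-neg c∈)))

    fill : (∃ λ a → Within 1# a × c * a ≈ α) → (∃ λ b → Within 1# b × c * b ≈ β) → K (α • q ⊕ β • q′)
    fill (a , a∈ , ca≈α) (b , b∈ , cb≈β) = K-resp (coordinate _ _ , coordinate _ _)
      (segment (K-resp (+-comm _ _ , +-comm _ _) (right-side b∈))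
               (K-resp (+-comm _ _ , +-comm _ _) (left-side b∈)) a∈)
      where
      coordinate : ∀ x y → b * (c * y) + a * (c * x) ≈ α * x + β * y
      coordinate x y = trans
        (solve 5 (λ a b c x y → b :* (c :* y) :+ a :* (c :* x) := c :* a :* x :+ c :* b :* y) refl a b c x y)
        (+-cong (*-congʳ ca≈α) (*-congʳ cb≈β))

  box : ∀ (E E′ : Edge) → ¬ cross (half E) (half E′) ≈ 0# →
        ∃ λ c → ½ < c × Box (centre E) (centre E′) c
  box E E′ nonparallel =
    smaller-bound (midpoint-interior E E′ nonparallel) (midpoint-interior E (opposite E′) nonparallel)
    where
    smaller-bound : (∃ λ c → ½ < c × (∀ {κ} → Within c κ → K (κ • (centre E ⊕ centre E′)))) →
                    (∃ λ c → ½ < c × (∀ {κ} → Within c κ → K (κ • (centre E ⊕ ⊝ centre E′)))) →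
                    ∃ λ c → ½ < c × Box (centre E) (centre E′) c
    smaller-bound (c , ½<c , K₊) (c′ , ½<c′ , K₋) = [ lesser , greater ]′ (total c c′)
      where
      lesser : c ≤ c′ → _
      lesser c≤c′ = c , ½<c , box-from-corners (<-≤-trans 0<½ (<⇒≤ ½<c)) K₊ (λ κ∈ → K₋ (Within-mono c≤c′ κ∈))
      greater : c′ ≤ c → _
      greater c′≤c = c′ , ½<c′ , box-from-corners (<-≤-trans 0<½ (<⇒≤ ½<c′)) (λ κ∈ → K₊ (Within-mono c′≤c κ∈)) K₋

  -- The translates on three axes.

  module Arrangement (E : Fin 3 → Edge)
    (supporting : ∀ d {z} → K z → cross (half (E d)) z ≤ cross (half (E d)) (centre (E d)))
    (width : ∀ d → 0# < cross (half (E d)) (centre (E d)))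
    {c : Carrier} (½<c : ½ < c) (c≤1 : c ≤ 1#)
    (boxes : ∀ d e → d ≢ e → Box (centre (E d)) (centre (E e)) c)
    where

    -- On `K` the linear functional `cross (half (E d))` is largest at the centre, where it is
    -- positive; at `κ` times the centre it takes `κ` times that value.
    ≤-along : ∀ d {κ} → K (κ • centre (E d)) → κ ≤ 1#
    ≤-along d {κ} Kκq = ≤-via
      (*-cancelˡ-nonNeg (width d) (≤-respʳ
        (solve 2 (λ h κ → h :- κ :* h := h :* (:1 :- κ)) refl (cross (half (E d)) (centre (E d))) κ)
        (0≤difference (≤-respˡ (cross-• (half (E d)) κ (centre (E d))) (supporting d Kκq)))))
      refl

    along : ∀ d {κ} → K (κ • centre (E d)) → Within 1# κ
    along d {κ} Kκq =
      ≤-via (0≤difference (≤-along d (K-resp (neg-* _ , neg-* _) (K-neg _ Kκq))))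
            (solve 1 (λ κ → κ :- :- :1 := :1 :- :- κ) refl κ) ,
      ≤-along d Kκq
      where
      neg-* : ∀ x → - (κ * x) ≈ - κ * x
      neg-* = solve 2 (λ κ x → :- (κ :* x) := :- κ :* x) refl κ

    -- Halving the distance to `c` yields infinitely many thresholds below `c`, so one arrangement
    -- serves all `n`.
    t : ℕ → Carrier
    t zero    = ½
    t (suc i) = ½ * (t i + c)

    t<c : ∀ i → t i < c
    t<c zero    = ½<c
    t<c (suc i) = <-via (*-pos 0<½ (0<difference (t<c i))) (trans
      (+-congʳ (½-elim (solve 2 (λ h c → (:1 :+ :1) :* h :* c := (:1 :+ :1) :* h :* c) refl ½ c)))
      (solve 3 (λ h t c → (:1 :+ :1) :* h :* c :- h :* (t :+ c) := h :* (c :- t)) refl ½ (t i) c))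

    t<tsuc : ∀ i → t i < t (suc i)
    t<tsuc i = <-via (*-pos 0<½ (0<difference (t<c i))) (trans
      (+-congˡ (-‿cong (½-elim refl)))
      (solve 3 (λ h t c → h :* (t :+ c) :- (:1 :+ :1) :* h :* t := h :* (c :- t)) refl ½ (t i) c))

    t-mono : ∀ {i j} → i ℕ.≤′ j → t i ≤ t j
    t-mono ℕ.≤′-refl        = ≤-refl
    t-mono {i} (ℕ.≤′-step {n = j} i≤j) = ≤-trans (t-mono i≤j) (<⇒≤ (t<tsuc j))

    t-cancel-≤ : ∀ {i j} → t i ≤ t j → i ℕ.≤ j
    t-cancel-≤ {i} {j} tᵢ≤tⱼ = ℕ.≮⇒≥ λ j<i →
      <⇒≱ (t<tsuc j) (≤-trans (t-mono (ℕ.≤⇒≤′ j<i)) tᵢ≤tⱼ)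

    0≤c : 0# ≤ c
    0≤c = ≤-trans (<⇒≤ 0<½) (<⇒≤ ½<c)

    ½≤t : ∀ i → ½ ≤ t i
    ½≤t i = t-mono {0} {i} (ℕ.≤⇒≤′ ℕ.z≤n)

    0≤t : ∀ i → 0# ≤ t i
    0≤t i = ≤-trans (<⇒≤ 0<½) (½≤t i)

    t≤1 : ∀ i → t i ≤ 1#
    t≤1 i = ≤-trans (<⇒≤ (t<c i)) c≤1

    offset : Bool × ℕ → Carrier
    offset (true  , i) = 1# - t i
    offset (false , i) = - t i

    1≈½+½ : 1# ≈ ½ + ½
    1≈½+½ = ½-elim (solve 1 (λ h → h :+ h := (:1 :+ :1) :* h :* :1) refl ½)

    Within-0≤ : ∀ {r x} → 0# ≤ x → x ≤ r → Within r x
    Within-0≤ {r} {x} 0≤x x≤r =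
      ≤-via (+-nonNeg 0≤x (≤-trans 0≤x x≤r)) (solve 2 (λ r x → x :- :- r := x :+ r) refl r x) , x≤r

    -- The start at `½` pays off for the positive offsets: `1 - t i ≤ ½ < c`.
    offset-within : ∀ x → Within c (offset x)
    offset-within (true , i) = Within-0≤ (0≤difference (t≤1 i))
      (≤-via (+-nonNeg (0≤difference (<⇒≤ ½<c)) (0≤difference (½≤t i)))
        (trans (+-congˡ (-‿cong (+-congʳ 1≈½+½)))
          (solve 3 (λ c h t → c :- (h :+ h :- t) := c :- h :+ (t :- h)) refl c ½ (t i))))
    offset-within (false , i) = Within-neg (Within-0≤ (0≤t i) (<⇒≤ (t<c i)))

    t-difference-within : ∀ i j → Within 1# (t j - t i)
    t-difference-within i j =
      ≤-via (+-nonNeg (0≤t j) (0≤difference (t≤1 i)))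
        (solve 2 (λ x y → y :- x :- :- :1 := y :+ (:1 :- x)) refl (t i) (t j)) ,
      ≤-via (+-nonNeg (0≤t i) (0≤difference (t≤1 j)))
        (solve 2 (λ x y → :1 :- (y :- x) := x :+ (:1 :- y)) refl (t i) (t j))

    -- Offsets of opposite kind differ by `1 - (t i - t j)` in absolute value, so exceeding 1
    -- amounts to comparing `t i` with `t j`, and `t` is strictly increasing.
    offset-Ordered : ∀ x y → Within 1# (offset x - offset y) → Ordered x y
    offset-Ordered (true , i) (false , j) (_ , ≤1) = t-cancel-≤ (≤-via (0≤difference ≤1)
      (solve 2 (λ x y → x :- y := :1 :- (:1 :- x :- :- y)) refl (t i) (t j)))
    offset-Ordered (false , i) (true , j) (-1≤ , _) = t-cancel-≤ (≤-via (0≤difference -1≤)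
      (solve 2 (λ x y → y :- x := :- x :- (:1 :- y) :- :- :1) refl (t i) (t j)))
    offset-Ordered (true  , _) (true  , _) _ = _
    offset-Ordered (false , _) (false , _) _ = _

    Ordered-offset : ∀ x y → Ordered x y → Within 1# (offset x - offset y)
    Ordered-offset (true , i) (false , j) j≤i =
      ≤-via (+-nonNeg (0≤difference (t≤1 i)) (+-nonNeg (<⇒≤ 0<1) (0≤t j)))
        (solve 2 (λ x y → :1 :- x :- :- y :- :- :1 := :1 :- x :+ (:1 :+ y)) refl (t i) (t j)) ,
      ≤-via (0≤difference (t-mono {j} {i} (ℕ.≤⇒≤′ j≤i)))
        (solve 2 (λ x y → :1 :- (:1 :- x :- :- y) := x :- y) refl (t i) (t j))
    Ordered-offset (false , i) (true , j) i≤j =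
      ≤-via (0≤difference (t-mono {i} {j} (ℕ.≤⇒≤′ i≤j)))
        (solve 2 (λ x y → :- x :- (:1 :- y) :- :- :1 := y :- x) refl (t i) (t j)) ,
      ≤-via (+-nonNeg (0≤difference (t≤1 j)) (+-nonNeg (<⇒≤ 0<1) (0≤t i)))
        (solve 2 (λ x y → :1 :- (:- x :- (:1 :- y)) := :1 :- y :+ (:1 :+ x)) refl (t i) (t j))
    Ordered-offset (true , i) (true , j) _ = Within-resp refl
      (solve 2 (λ x y → y :- x := :1 :- x :- (:1 :- y)) refl (t i) (t j)) (t-difference-within i j)
    Ordered-offset (false , i) (false , j) _ = Within-resp refl
      (solve 2 (λ x y → y :- x := :- x :- :- y) refl (t i) (t j)) (t-difference-within i j)

    x≈y⇒x-y≈0 : ∀ {x y} → x ≈ y → x - y ≈ 0#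
    x≈y⇒x-y≈0 {x} {y} x≈y = trans (+-congʳ x≈y) (-‿inverseʳ y)

    opposite-offsets : ∀ i j → ¬ 1# - t i ≈ - t j
    opposite-offsets i j eq = 0<⇒≉0
      (+-pos-nonNeg (0<difference (<-≤-trans (t<c i) c≤1)) (0≤t j))
      (trans (+-congʳ eq) (-‿inverseˡ (t j)))

    offset-injective : ∀ x y → offset x ≈ offset y → x ≡ y
    offset-injective (true , i) (true , j) eq = ≡.cong (true ,_) (ℕ.≤-antisym
      (t-cancel-≤ (≤-via (≤-reflexive (sym (x≈y⇒x-y≈0 eq)))
        (solve 2 (λ x y → y :- x := :1 :- x :- (:1 :- y)) refl (t i) (t j))))
      (t-cancel-≤ (≤-via (≤-reflexive (sym (x≈y⇒x-y≈0 (sym eq))))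
        (solve 2 (λ x y → x :- y := :1 :- y :- (:1 :- x)) refl (t i) (t j)))))
    offset-injective (false , i) (false , j) eq = ≡.cong (false ,_) (ℕ.≤-antisym
      (t-cancel-≤ (≤-via (≤-reflexive (sym (x≈y⇒x-y≈0 eq)))
        (solve 2 (λ x y → y :- x := :- x :- :- y) refl (t i) (t j))))
      (t-cancel-≤ (≤-via (≤-reflexive (sym (x≈y⇒x-y≈0 (sym eq))))
        (solve 2 (λ x y → x :- y := :- y :- :- x) refl (t i) (t j)))))
    offset-injective (true  , i) (false , j) eq = contradiction eq (opposite-offsets i j)
    offset-injective (false , i) (true  , j) eq = contradiction (sym eq) (opposite-offsets j i)

    position : Label → Point
    position (d , x) = offset x • centre (E d)

    difference-along : ∀ d a b → (a • centre (E d) ⊖ b • centre (E d)) ≈ₚ (a - b) • centre (E d)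
    difference-along d a b = coordinate _ , coordinate _
      where
      coordinate : ∀ x → a * x - b * x ≈ (a - b) * x
      coordinate = solve 3 (λ a b x → a :* x :- b :* x := (a :- b) :* x) refl a b

    difference-across : ∀ {d e a b} → d ≢ e → Within c a → Within c b →
                        K (a • centre (E d) ⊖ b • centre (E e))
    difference-across {d} {e} {a} {b} d≢e a∈ b∈ =
      K-resp (coordinate _ _ , coordinate _ _) (boxes d e d≢e a (- b) a∈ (Within-neg b∈))
      where
      coordinate : ∀ x y → a * x + - b * y ≈ a * x - b * y
      coordinate = solve 4 (λ a b x y → a :* x :+ :- b :* y := a :* x :- b :* y) refl a b

    K-Compatible : ∀ u v → K (position u ⊖ position v) → Compatible u v
    K-Compatible (d , x) (.d , y) K₋ ≡.refl =
      offset-Ordered x y (along d (K-resp (difference-along d _ _) K₋))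

    unit : ∀ d → K (centre (E d))
    unit d = K-resp (coordinate _ _ , coordinate _ _)
      (segment (end₊ (E d)) (end₋ (E d))
        (Within-0≤ ≤-refl (<⇒≤ 0<1)))
      where
      coordinate : ∀ x y → x + 0# * y ≈ x
      coordinate = solve 2 (λ x y → x :+ :0 :* y := x) refl

    Compatible-K : ∀ u v → Compatible u v → K (position u ⊖ position v)
    Compatible-K (d , x) (e , y) compat with d Fin.≟ e
    ... | yes ≡.refl = K-resp (≈ₚ-sym (difference-along d _ _))
                         (shrink (unit d) (Ordered-offset x y (compat ≡.refl)))
    ... | no d≢e = difference-across d≢e (offset-within x) (offset-within y)

    Same : Rel Label 0ℓ
    Same u v = ∀ z → K (position u ⊖ z) → K (position v ⊖ z)

    -- This is what makes the translates distinct as sets: equal sets are met by the same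
    -- translates, so it suffices to find, for different labels, a translate meeting only one of the
    -- two.
    position-separated : ∀ u v → Same u v → Same v u → u ≡ v
    position-separated (d , x) (e , y) u⊆v v⊆u with d Fin.≟ e
    ... | yes ≡.refl = ≡.cong (d ,_) (offset-injective x y (antisym (offset-≤ x y v⊆u) (offset-≤ y x u⊆v)))
      where
      -- The test translate at `offset y - 1` only just meets the one at `offset y`. If it also
      -- meets the one at `offset x`, the latter offset cannot be larger.
      offset-≤ : ∀ x y → Same (d , y) (d , x) → offset x ≤ offset y
      offset-≤ x y y⊆x = ≤-via (0≤difference (proj₂ (along d (K-resp (difference-along d _ _)
          (y⊆x ((offset y - 1#) • centre (E d)) (K-resp (≈ₚ-sym (difference-along d _ _))
            (shrink (unit d) (Within-resp refl
              (solve 1 (λ b → :1 := b :- (b :- :1)) refl (offset y)) (Within-0≤ (<⇒≤ 0<1) ≤-refl)))))))))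
        (solve 2 (λ a b → b :- a := :1 :- (a :- (b :- :1))) refl (offset x) (offset y))
    ... | no d≢e = contradiction
      (along d (K-resp (difference-along d _ _)
        (v⊆u (probe x • centre (E d)) (difference-across (λ e≡d → d≢e (≡.sym e≡d)) (offset-within y) (probe-within x)))))
      (probe-disjoint x)
      where
      -- A translate on the same axis as u, disjoint from u but close enough to
      -- the origin to meet every translate on another axis.
      probe : Bool × ℕ → Carrier
      probe (true  , _) = - c
      probe (false , _) = c

      probe-within : ∀ x → Within c (probe x)
      probe-within (true  , _) = Within-neg (Within-0≤ 0≤c ≤-refl)
      probe-within (false , _) = Within-0≤ 0≤c ≤-refl

      -- The distances are `1 - t i + c` and `t i + c`; they exceed 1 because `t i < c` in the first
      -- case and `½ ≤ t i`, `½ < c` in the second.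
      probe-disjoint : ∀ x → ¬ Within 1# (offset x - probe x)
      probe-disjoint (true , i) (_ , ≤1) = <⇒≱ (t<c i) (≤-via (0≤difference ≤1)
        (solve 2 (λ t c → t :- c := :1 :- (:1 :- t :- :- c)) refl (t i) c))
      probe-disjoint (false , i) (-1≤ , _) = <⇒≱
        (+-pos-nonNeg (0<difference ½<c) (0≤difference (½≤t i)))
        (≤-via (0≤difference -1≤) (trans
          (solve 3 (λ h t c → :0 :- (c :- h :+ (t :- h)) := :- t :- c :+ (h :+ h)) refl ½ (t i) c)
          (trans (+-congˡ (sym 1≈½+½)) (solve 2 (λ t c → :- t :- c :+ :1 := :- t :- c :- :- :1) refl (t i) c))))

  octahedron : (E : Fin 3 → Edge) →
    (∀ d {z} → K z → cross (half (E d)) z ≤ cross (half (E d)) (centre (E d))) →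
    (∀ d → 0# < cross (half (E d)) (centre (E d))) →
    (∀ d e → d ≢ e → ¬ cross (half (E d)) (half (E e)) ≈ 0#) →
    Σ[ position ∈ (Label → Point) ]
      (∀ u v → K (position u ⊖ position v) ⇔ Compatible u v) ×
      (∀ u v → (∀ z → K (position u ⊖ z) → K (position v ⊖ z)) →
               (∀ z → K (position v ⊖ z) → K (position u ⊖ z)) → u ≡ v)
  octahedron E supporting width nonparallel =
    build (uniform-bound ½<1 (λ d c → ∀ e → d ≢ e → Box (centre (E d)) (centre (E e)) c)
      (λ d c′≤c b e d≢e → Box-mono c′≤c (b e d≢e))
      (λ d → forget (uniform-bound ½<1 (λ e c → d ≢ e → Box (centre (E d)) (centre (E e)) c)
        (λ e c′≤c b d≢e → Box-mono c′≤c (b d≢e))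
        (λ e → pair d e))))
    where
    ½<1 : ½ < 1#
    ½<1 = <-via 0<½ (trans (+-congʳ (½-elim {1#} refl)) (solve 1 (λ h → (:1 :+ :1) :* h :* :1 :- h := h) refl ½))

    forget : ∀ {Q : Pred Carrier 0ℓ} → (∃ λ c → ½ < c × c ≤ 1# × Q c) → ∃ λ c → ½ < c × Q c
    forget (c , ½<c , _ , q) = c , ½<c , q

    pair : ∀ d e → ∃ λ c → ½ < c × (d ≢ e → Box (centre (E d)) (centre (E e)) c)
    pair d e with d Fin.≟ e
    -- No box is asked for on the diagonal; 1 is a default value above `½`.
    ... | yes d≡e = 1# , ½<1 , λ d≢e → contradiction d≡e d≢e
    ... | no d≢e = let c , ½<c , b = box (E d) (E e) (nonparallel d e d≢e) in c , ½<c , λ _ → b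

    build : (∃ λ c → ½ < c × c ≤ 1# × (∀ d e → d ≢ e → Box (centre (E d)) (centre (E e)) c)) → _
    build (c , ½<c , c≤1 , boxes) = position , (λ u v → mk⇔ (K-Compatible u v) (Compatible-K u v)) , position-separated
      where open Arrangement E supporting width ½<c c≤1 boxes

-- Translates of a convex set and its difference body.

module Homothets (em : ExcludedMiddle 0ℓ) (R : RealNumbers) (P : Pred (Plane.Point R) 0ℓ)
  (P-isConvex : PlaneAlgebra.IsConvexSet R P)
  where

  open PlaneAlgebra R
  open IsConvexSet P-isConvex renaming (convex to P-convex)

  Difference : Pred Point 0ℓ
  Difference z = ∃₂ λ x y → P x × P y × z ≈ₚ x ⊖ y

  Difference-convex : ∀ {p q s t} → Difference p → Difference q → 0# ≤ s → 0# ≤ t → s + t ≈ 1# →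
                      Difference (s • p ⊕ t • q)
  Difference-convex {s = s} {t} (x , y , Px , Py , eq₁ , eq₂) (x′ , y′ , Px′ , Py′ , eq₁′ , eq₂′) 0≤s 0≤t s+t≈1 =
    s • x ⊕ t • x′ , s • y ⊕ t • y′ , P-convex Px Px′ 0≤s 0≤t s+t≈1 , P-convex Py Py′ 0≤s 0≤t s+t≈1 ,
    trans (+-cong (*-congˡ eq₁) (*-congˡ eq₁′)) (coordinate _ _ _ _) ,
    trans (+-cong (*-congˡ eq₂) (*-congˡ eq₂′)) (coordinate _ _ _ _)
    where
    coordinate : ∀ x y x′ y′ → s * (x - y) + t * (x′ - y′) ≈ s * x + t * x′ - (s * y + t * y′)
    coordinate = solve 6 (λ s t x y x′ y′ →
      s :* (x :- y) :+ t :* (x′ :- y′) := s :* x :+ t :* x′ :- (s :* y :+ t :* y′)) refl s t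

  Difference-isConvex : IsConvexSet Difference
  Difference-isConvex = record
    { resp   = λ p≈q (x , y , Px , Py , eq) → x , y , Px , Py , ≈ₚ-trans (≈ₚ-sym p≈q) eq
    ; convex = λ {p} {q} {s} {t} → Difference-convex {p} {q} {s} {t}
    }

  Difference-neg : IsSymmetric Difference
  Difference-neg _ (x , y , Px , Py , eq₁ , eq₂) = y , x , Py , Px , coordinate eq₁ , coordinate eq₂
    where
    coordinate : ∀ {z x y} → z ≈ x - y → - z ≈ y - x
    coordinate {z} {x} {y} eq = trans (-‿cong eq) (solve 2 (λ x y → :- (x :- y) := y :- x) refl x y)

  record Side : Set where
    field
      start end far : Point
      P-start       : P start
      P-end         : P end
      P-far         : P far

    direction : Point
    direction = end ⊖ start

    height : Point → Carrier
    height p = cross direction (p ⊖ start)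

    field
      height-nonNeg : ∀ {p} → P p → 0# ≤ height p
      height-≤-far  : ∀ {p} → P p → height p ≤ height far
      height-far    : 0# < height far

  open Octahedron R Difference Difference-isConvex Difference-neg

  module _ (S : Side) where
    open Side S

    -- Subtracting the points of the side from the farthest point `far` sweeps the segment from
    -- `far - end` to `far - start`, which lies in `P - P` at the greatest height. If `P` has a
    -- second side parallel to this one, it may be only part of an edge of `P - P`, and its midpoint
    -- serves equally well.
    side-edge : Edge
    side-edge = record
      { centre = ½ • ((far ⊖ start) ⊕ (far ⊖ end))
      ; half   = ½ • direction
      ; end₊   = far , start , P-far , P-start , coordinate₊ _ _ _ , coordinate₊ _ _ _
      ; end₋   = far , end , P-far , P-end , coordinate₋ _ _ _ , coordinate₋ _ _ _
      }
      where
      coordinate₊ : ∀ f a b → ½ * ((f - a) + (f - b)) + ½ * (b - a) ≈ f - a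
      coordinate₊ f a b = sym (½-elim (solve 4 (λ h f a b →
        h :* ((f :- a) :+ (f :- b)) :+ h :* (b :- a) := (:1 :+ :1) :* h :* (f :- a)) refl ½ f a b))
      coordinate₋ : ∀ f a b → ½ * ((f - a) + (f - b)) - ½ * (b - a) ≈ f - b
      coordinate₋ f a b = sym (½-elim (solve 4 (λ h f a b →
        h :* ((f :- a) :+ (f :- b)) :- h :* (b :- a) := (:1 :+ :1) :* h :* (f :- b)) refl ½ f a b))

    open Edge side-edge

    cross-centre : ½ * height far ≈ cross half centre
    cross-centre = ½-elim (identity (proj₁ far) (proj₂ far) (proj₁ start) (proj₂ start) (proj₁ end) (proj₂ end))
      where
      identity : ∀ f₁ f₂ a₁ a₂ b₁ b₂ →
        cross (½ * (b₁ - a₁) , ½ * (b₂ - a₂)) (½ * ((f₁ - a₁) + (f₁ - b₁)) , ½ * ((f₂ - a₂) + (f₂ - b₂))) ≈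
        (1# + 1#) * ½ * (½ * cross (b₁ - a₁ , b₂ - a₂) (f₁ - a₁ , f₂ - a₂))
      identity = solve 7 (λ h f₁ f₂ a₁ a₂ b₁ b₂ →
        h :* (b₁ :- a₁) :* (h :* ((f₂ :- a₂) :+ (f₂ :- b₂))) :- h :* (b₂ :- a₂) :* (h :* ((f₁ :- a₁) :+ (f₁ :- b₁)))
        := (:1 :+ :1) :* h :* (h :* ((b₁ :- a₁) :* (f₂ :- a₂) :- (b₂ :- a₂) :* (f₁ :- a₁)))) refl ½

    cross-difference : ∀ {x y z} → z ≈ₚ x ⊖ y → cross half z ≈ ½ * (height x - height y)
    cross-difference {x} {y} (eq₁ , eq₂) =
      trans (cross-cong ≈ₚ-refl (eq₁ , eq₂)) (identity (proj₁ x) (proj₂ x) (proj₁ y) (proj₂ y)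
        (proj₁ direction) (proj₂ direction) (proj₁ start) (proj₂ start))
      where
      identity : ∀ x₁ x₂ y₁ y₂ u₁ u₂ a₁ a₂ →
        cross (½ * u₁ , ½ * u₂) (x₁ - y₁ , x₂ - y₂) ≈
        ½ * (cross (u₁ , u₂) (x₁ - a₁ , x₂ - a₂) - cross (u₁ , u₂) (y₁ - a₁ , y₂ - a₂))
      identity = solve 9 (λ h x₁ x₂ y₁ y₂ u₁ u₂ a₁ a₂ →
        h :* u₁ :* (x₂ :- y₂) :- h :* u₂ :* (x₁ :- y₁)
        := h :* (u₁ :* (x₂ :- a₂) :- u₂ :* (x₁ :- a₁) :- (u₁ :* (y₂ :- a₂) :- u₂ :* (y₁ :- a₁)))) refl ½

    -- On `x - y` the functional is half of `height x - height y`, which is largest for `x` at `far`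
    -- and `y` on the side.
    side-supporting : ∀ {z} → Difference z → cross half z ≤ cross half centre
    side-supporting {z} (x , y , Px , Py , z≈) =
      ≤-respˡ (sym (cross-difference {x} {y} {z} z≈)) (≤-respʳ cross-centre
        (≤-via (*-nonNeg (<⇒≤ 0<½) (+-nonNeg (height-nonNeg Py) (0≤difference (height-≤-far Px))))
          (solve 4 (λ h x y f → h :* f :- h :* (x :- y) := h :* (y :+ (f :- x))) refl
            ½ (height x) (height y) (height far))))

    side-width : 0# < cross half centre
    side-width = 0<-resp cross-centre (*-pos 0<½ height-far)

  translate : Point → Homothety
  translate c = record { scale = 1# ; scale-positive = 0<1 ; translation = c }

  translates-meet : ∀ c c′ → Difference (c ⊖ c′) ⇔ (image (translate c) P ≬ image (translate c′) P)
  translates-meet c c′ = mk⇔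
    (λ (x , y , Px , Py , eq₁ , eq₂) → y ⊕ c ,
      (y , Py , +-congʳ (sym (*-identityˡ _)) , +-congʳ (sym (*-identityˡ _))) ,
      (x , Px , meet eq₁ , meet eq₂))
    (λ (q , (y , Py , eq₁ , eq₂) , (x , Px , eq₁′ , eq₂′)) → x , y , Px , Py , separate eq₁ eq₁′ , separate eq₂ eq₂′)
    where
    meet : ∀ {c c′ x y} → c - c′ ≈ x - y → y + c ≈ 1# * x + c′
    meet {c} {c′} {x} {y} eq = trans
      (solve 3 (λ c c′ y → y :+ c := c :- c′ :+ (y :+ c′)) refl c c′ y)
      (trans (+-congʳ eq) (solve 3 (λ c′ x y → x :- y :+ (y :+ c′) := :1 :* x :+ c′) refl c′ x y))
    separate : ∀ {c c′ x y q} → q ≈ 1# * y + c → q ≈ 1# * x + c′ → c - c′ ≈ x - y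
    separate {c} {c′} {x} {y} {q} eq eq′ = trans
      (solve 3 (λ c c′ y → c :- c′ := :1 :* y :+ c :- c′ :- y) refl c c′ y)
      (trans (+-congʳ (+-congʳ (trans (sym eq) eq′)))
        (solve 3 (λ c′ x y → :1 :* x :+ c′ :- c′ :- y := x :- y) refl c′ x y))

  -- Adjacency must be Boolean, so excluded middle decides whether two sets meet; `i ≢ j` is built
  -- in because every nonempty set meets itself.
  intersectionGraph : ∀ {n} → (Fin n → Homothety) → Graph n
  intersectionGraph h = record
    { adjacent = λ i j → isYes (em {i ≢ j × (image (h i) P ≬ image (h j) P)})
    ; ~-sym    = λ {i} {j} i~j → let i≢j , q , qi , qj = toWitness i~j in
                 fromWitness ((λ j≡i → i≢j (≡.sym j≡i)) , q , qj , qi)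
    ; ~-irrefl = λ i~i → proj₁ (toWitness i~i) ≡.refl
    }

  intersectionGraph-adjacency : ∀ {n} (h : Fin n → Homothety) →
    ∀ i j → i ≢ j → Graph._~_ (intersectionGraph h) i j ⇔ (image (h i) P ≬ image (h j) P)
  intersectionGraph-adjacency h i j i≢j = mk⇔
    (λ i~j → proj₂ (toWitness i~j))
    (λ meets → fromWitness (i≢j , meets))

  many-maximal-cliques : (S : Fin 3 → Side) →
    (∀ d e → d ≢ e → ¬ cross (Side.direction (S d)) (Side.direction (S e)) ≈ 0#) →
    ∀ n → Σ[ G ∈ Graph n ] Hom P G × (n / 6) ^ 3 ℕ.≤ numberOfMaximalCliques G
  many-maximal-cliques S nonparallel n =
    build (octahedron (λ d → side-edge (S d)) (λ d → side-supporting (S d)) (λ d → side-width (S d))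
      λ d e d≢e eq → nonparallel d e d≢e (*-cancelˡ-0 (0<⇒≉0 (*-pos 0<½ 0<½))
        (trans (sym (cross-½ (Side.direction (S d)) (Side.direction (S e)))) eq)))
    where
    cross-½ : ∀ u v → cross (½ • u) (½ • v) ≈ ½ * ½ * cross u v
    cross-½ (u₁ , u₂) (v₁ , v₂) = solve 5 (λ h u₁ u₂ v₁ v₂ →
      h :* u₁ :* (h :* v₂) :- h :* u₂ :* (h :* v₁) := h :* h :* (u₁ :* v₂ :- u₂ :* v₁)) refl ½ u₁ u₂ v₁ v₂

    build : (Σ[ position ∈ (Label → Point) ]
      (∀ u v → Difference (position u ⊖ position v) ⇔ Compatible u v) ×
      (∀ u v → (∀ z → Difference (position u ⊖ z) → Difference (position v ⊖ z)) →
               (∀ z → Difference (position v ⊖ z) → Difference (position u ⊖ z)) → u ≡ v)) →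
      Σ[ G ∈ Graph n ] Hom P G × (n / 6) ^ 3 ℕ.≤ numberOfMaximalCliques G
    build (position , compatible , separated) =
      intersectionGraph h , (h , distinct , intersectionGraph-adjacency h) ,
      CliqueCount.[n/6]³≤numberOfMaximalCliques (intersectionGraph h) λ {u} {v} u≢v →
        let adjacency = intersectionGraph-adjacency h u v u≢v
            meets     = translates-meet (position (decode (toℕ u))) (position (decode (toℕ v)))
            compat    = compatible (decode (toℕ u)) (decode (toℕ v))
        in mk⇔ (λ u~v → Equivalence.to compat (Equivalence.from meets (Equivalence.to adjacency u~v)))
               (λ c → Equivalence.from adjacency (Equivalence.to meets (Equivalence.from compat c)))
      where
      h : Fin n → Homothety
      h v = translate (position (decode (toℕ v)))

      -- Whatever meets a set meets every larger set, so an inclusion between translates passes to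
      -- the translates they meet, the form in which `separated` takes it.
      near : ∀ c c′ → (∀ {q} → image (translate c) P q → image (translate c′) P q) →
             ∀ z → Difference (c ⊖ z) → Difference (c′ ⊖ z)
      near c c′ c⊆c′ z K = let q , qc , qz = Equivalence.to (translates-meet c z) K in
        Equivalence.from (translates-meet c′ z) (q , c⊆c′ qc , qz)

      distinct : ∀ i j → image (h i) P ≐ image (h j) P → i ≡ j
      distinct i j (i⊆j , j⊆i) = Fin.toℕ-injective (decode-injective (separated _ _
        (near _ _ i⊆j) (near _ _ j⊆i)))

  maximum-cubic : (S : Fin 3 → Side) →
    (∀ d e → d ≢ e → ¬ cross (Side.direction (S d)) (Side.direction (S e)) ≈ 0#) →
    Σ[ f ∈ (ℕ → ℕ) ] (∀ n → IsMaximumMaximalCliques (Hom P) n (f n)) × f ∈Ω (λ n → n ^ 3)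
  maximum-cubic S nonparallel =
    (λ n → proj₁ (attained n)) ,
    (λ n → proj₁ (proj₂ (attained n)) , λ G hom → proj₂ (proj₂ (attained n)) _ (G , hom , ≡.refl)) ,
    1728 , 6 , s≤s z≤n , λ n 6≤n → ℕ.≤-trans (n³≤1728[n/6]³ n 6≤n) (ℕ.*-monoʳ-≤ 1728
      (let G , hom , many = many-maximal-cliques S nonparallel n in
       ℕ.≤-trans many (proj₂ (proj₂ (attained n)) _ (G , hom , ≡.refl))))
    where
    -- The number of vertex sets bounds the search, and the construction, available for small `n`
    -- too, shows that some value is attained.
    attained : ∀ n → ∃ λ m → (Σ[ G ∈ Graph n ] Hom P G × numberOfMaximalCliques G ≡ m) ×
      (∀ k → (Σ[ G ∈ Graph n ] Hom P G × numberOfMaximalCliques G ≡ k) → k ℕ.≤ m)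
    attained n = bounded-maximum em _ (length (subsets n))
      (λ { _ (G , _ , ≡.refl) → numberOfMaximalCliques-≤ G })
      (let G , hom , _ = many-maximal-cliques S nonparallel n in _ , G , hom , ≡.refl)

-- Convex hulls and orientations of triples.

module ConvexHulls (R : RealNumbers) where

  open PlaneAlgebra R public

  sum-cong : ∀ {k} {f g : Fin k → Carrier} → (∀ i → f i ≈ g i) → sum f ≈ sum g
  sum-cong {zero}  f≈g = refl
  sum-cong {suc k} f≈g = +-cong (f≈g zero) (sum-cong (λ i → f≈g (suc i)))

  sum-linear : ∀ {k} s t (f g : Fin k → Carrier) →
    sum (λ i → s * f i + t * g i) ≈ s * sum f + t * sum g
  sum-linear {zero}  s t f g = solve 2 (λ s t → :0 := s :* :0 :+ t :* :0) refl s t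
  sum-linear {suc k} s t f g = trans (+-congˡ (sum-linear s t (λ i → f (suc i)) (λ i → g (suc i))))
    (solve 6 (λ s t f g F G → s :* f :+ t :* g :+ (s :* F :+ t :* G) := s :* (f :+ F) :+ t :* (g :+ G)) refl
      s t (f zero) (g zero) _ _)

  sum-nonNeg : ∀ {k} {f : Fin k → Carrier} → (∀ i → 0# ≤ f i) → 0# ≤ sum f
  sum-nonNeg {zero}  0≤f = ≤-refl
  sum-nonNeg {suc k} 0≤f = +-nonNeg (0≤f zero) (sum-nonNeg (λ i → 0≤f (suc i)))

  indicator : ∀ {k} → Fin k → Fin k → Carrier
  indicator zero    zero    = 1#
  indicator zero    (suc _) = 0#
  indicator (suc _) zero    = 0#
  indicator (suc i) (suc j) = indicator i j

  indicator-nonNeg : ∀ {k} (i j : Fin k) → 0# ≤ indicator i j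
  indicator-nonNeg zero    zero    = <⇒≤ 0<1
  indicator-nonNeg zero    (suc _) = ≤-refl
  indicator-nonNeg (suc _) zero    = ≤-refl
  indicator-nonNeg (suc i) (suc j) = indicator-nonNeg i j

  sum-zero : ∀ {k} (f : Fin k → Carrier) → sum (λ i → 0# * f i) ≈ 0#
  sum-zero {zero}  f = refl
  sum-zero {suc k} f = trans (+-cong (zeroˡ (f zero)) (sum-zero (λ i → f (suc i)))) (+-identityˡ 0#)

  sum-indicator : ∀ {k} (i : Fin k) (f : Fin k → Carrier) → sum (λ j → indicator i j * f j) ≈ f i
  sum-indicator zero    f = trans (+-cong (*-identityˡ (f zero)) (sum-zero (λ j → f (suc j)))) (+-identityʳ _)
  sum-indicator (suc i) f = trans (+-cong (zeroˡ (f zero)) (sum-indicator i (λ j → f (suc j)))) (+-identityˡ _)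

  module _ {k} (v : Fin k → Point) where

    hull-resp : ∀ {p q} → p ≈ₚ q → ConvexHull v p → ConvexHull v q
    hull-resp p≈q (w , 0≤w , Σw≈1 , eq) = w , 0≤w , Σw≈1 , ≈ₚ-trans (≈ₚ-sym p≈q) eq

    hull-vertex : ∀ i → ConvexHull v (v i)
    hull-vertex i = indicator i , indicator-nonNeg i ,
      trans (sum-cong (λ j → sym (*-identityʳ (indicator i j)))) (sum-indicator i (λ _ → 1#)) ,
      sym (sum-indicator i (λ j → proj₁ (v j))) , sym (sum-indicator i (λ j → proj₂ (v j)))

    hull-convex : ∀ {p q s t} → ConvexHull v p → ConvexHull v q → 0# ≤ s → 0# ≤ t → s + t ≈ 1# →
                  ConvexHull v (s • p ⊕ t • q)
    hull-convex {s = s} {t} (w , 0≤w , Σw≈1 , eq₁ , eq₂) (w′ , 0≤w′ , Σw′≈1 , eq₁′ , eq₂′) 0≤s 0≤t s+t≈1 =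
      (λ i → s * w i + t * w′ i) ,
      (λ i → +-nonNeg (*-nonNeg 0≤s (0≤w i)) (*-nonNeg 0≤t (0≤w′ i))) ,
      trans (sum-linear s t w w′) (trans (+-cong (*-congˡ Σw≈1) (*-congˡ Σw′≈1))
        (trans (+-cong (*-identityʳ s) (*-identityʳ t)) s+t≈1)) ,
      coordinate eq₁ eq₁′ , coordinate eq₂ eq₂′
      where
      coordinate : ∀ {f : Fin k → Carrier} {x y} → x ≈ sum (λ i → w i * f i) → y ≈ sum (λ i → w′ i * f i) →
        s * x + t * y ≈ sum (λ i → (s * w i + t * w′ i) * f i)
      coordinate {f} eq eq′ = trans (+-cong (*-congˡ eq) (*-congˡ eq′))
        (trans (sym (sum-linear s t (λ i → w i * f i) (λ i → w′ i * f i)))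
          (sum-cong (λ i → solve 5 (λ s t w w′ x → s :* (w :* x) :+ t :* (w′ :* x) := (s :* w :+ t :* w′) :* x) refl
            s t (w i) (w′ i) (f i))))

    -- Since the weights sum to 1, an affine function takes at a convex combination the same
    -- combination of its values at the vertices.
    hull-half-plane : ∀ α β γ → (∀ i → 0# ≤ α * proj₁ (v i) + β * proj₂ (v i) + γ) →
      ∀ {p} → ConvexHull v p → 0# ≤ α * proj₁ p + β * proj₂ p + γ
    hull-half-plane α β γ 0≤v {p} (w , 0≤w , Σw≈1 , eq₁ , eq₂) =
      ≤-respʳ affine (sum-nonNeg (λ i → *-nonNeg (0≤w i) (0≤v i)))
      where
      x y : Fin k → Carrier
      x i = proj₁ (v i)
      y i = proj₂ (v i)

      affine : sum (λ i → w i * (α * x i + β * y i + γ)) ≈ α * proj₁ p + β * proj₂ p + γ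
      affine = trans
        (trans (sum-cong (λ i → solve 6 (λ α β γ w x y →
            w :* (α :* x :+ β :* y :+ γ) := :1 :* (α :* (w :* x) :+ β :* (w :* y)) :+ γ :* w) refl
            α β γ (w i) (x i) (y i)))
          (trans (sum-linear 1# γ (λ i → α * (w i * x i) + β * (w i * y i)) w)
            (+-congʳ (trans (*-identityˡ _) (sum-linear α β (λ i → w i * x i) (λ i → w i * y i))))))
        (+-cong (+-cong (*-congˡ (sym eq₁)) (*-congˡ (sym eq₂)))
          (trans (*-congˡ Σw≈1) (*-identityʳ γ)))

  -- Twice the signed area of the triangle, positive if it is traversed counterclockwise.
  turn : Point → Point → Point → Carrier
  turn p q r = cross (q ⊖ p) (r ⊖ p)

  turn-rotate : ∀ p q r → turn p q r ≈ turn q r p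
  turn-rotate (p₁ , p₂) (q₁ , q₂) (r₁ , r₂) = solve 6 (λ p₁ p₂ q₁ q₂ r₁ r₂ →
    (q₁ :- p₁) :* (r₂ :- p₂) :- (q₂ :- p₂) :* (r₁ :- p₁) :=
    (r₁ :- q₁) :* (p₂ :- q₂) :- (r₂ :- q₂) :* (p₁ :- q₁)) refl p₁ p₂ q₁ q₂ r₁ r₂

  turn-end : ∀ p q → turn p q q ≈ 0#
  turn-end (p₁ , p₂) (q₁ , q₂) = solve 4 (λ p₁ p₂ q₁ q₂ →
    (q₁ :- p₁) :* (q₂ :- p₂) :- (q₂ :- p₂) :* (q₁ :- p₁) := :0) refl p₁ p₂ q₁ q₂

  turn-start : ∀ p q → turn p q p ≈ 0#
  turn-start p q = trans (sym (turn-rotate p p q)) (trans (sym (turn-rotate q p p)) (turn-end q p))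

  turn-directions : ∀ p q r → turn p q r ≈ cross (q ⊖ p) (r ⊖ q)
  turn-directions (p₁ , p₂) (q₁ , q₂) (r₁ , r₂) = solve 6 (λ p₁ p₂ q₁ q₂ r₁ r₂ →
    (q₁ :- p₁) :* (r₂ :- p₂) :- (q₂ :- p₂) :* (r₁ :- p₁) :=
    (q₁ :- p₁) :* (r₂ :- q₂) :- (q₂ :- p₂) :* (r₁ :- q₁)) refl p₁ p₂ q₁ q₂ r₁ r₂

  -- Brings `turn p q` into the shape that `hull-half-plane` accepts.
  turn-affine : ∀ (p q r : Point) → let (p₁ , p₂) = p ; (q₁ , q₂) = q ; (r₁ , r₂) = r in
    (p₂ - q₂) * r₁ + (q₁ - p₁) * r₂ + ((q₂ - p₂) * p₁ - (q₁ - p₁) * p₂) ≈ turn p q r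
  turn-affine (p₁ , p₂) (q₁ , q₂) (r₁ , r₂) = solve 6 (λ p₁ p₂ q₁ q₂ r₁ r₂ →
    (p₂ :- q₂) :* r₁ :+ (q₁ :- p₁) :* r₂ :+ ((q₂ :- p₂) :* p₁ :- (q₁ :- p₁) :* p₂) :=
    (q₁ :- p₁) :* (r₂ :- p₂) :- (q₂ :- p₂) :* (r₁ :- p₁)) refl p₁ p₂ q₁ q₂ r₁ r₂

  cross-swap : ∀ u v → cross u v ≈ - cross v u
  cross-swap (u₁ , u₂) (v₁ , v₂) = solve 4 (λ u₁ u₂ v₁ v₂ →
    u₁ :* v₂ :- u₂ :* v₁ := :- (v₁ :* u₂ :- v₂ :* u₁)) refl u₁ u₂ v₁ v₂

  -- A Plücker relation.
  cross-parallel : ∀ a b x y → cross y b ≈ 0# → cross a b * cross x y ≈ cross x b * cross a y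
  cross-parallel (a₁ , a₂) (b₁ , b₂) (x₁ , x₂) (y₁ , y₂) y∥b = trans
    (solve 8 (λ a₁ a₂ b₁ b₂ x₁ x₂ y₁ y₂ →
      (a₁ :* b₂ :- a₂ :* b₁) :* (x₁ :* y₂ :- x₂ :* y₁) :=
      (x₁ :* b₂ :- x₂ :* b₁) :* (a₁ :* y₂ :- a₂ :* y₁) :+ (a₁ :* x₂ :- a₂ :* x₁) :* (y₂ :* b₁ :- y₁ :* b₂)) refl
      a₁ a₂ b₁ b₂ x₁ x₂ y₁ y₂)
    (trans (+-congˡ (trans (*-congˡ (trans (solve 4 (λ b₁ b₂ y₁ y₂ → y₂ :* b₁ :- y₁ :* b₂ := :- (y₁ :* b₂ :- y₂ :* b₁)) refl b₁ b₂ y₁ y₂)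
       (trans (-‿cong y∥b) (solve 0 (:- :0 := :0) refl)))) (zeroʳ _))) (+-identityʳ _))

  ConvexPosition : ∀ {k} → (Fin k → Point) → Set
  ConvexPosition v = ∀ i j l → i Fin.< j → j Fin.< l → 0# < turn (v i) (v j) (v l)

  -- Vertices 1 and 2 contain the first spanning vector, 2 and 3 the second, so the coefficients are
  -- the sums of these weights. Conversely, the products of `1 - s`, `s` with `1 - t`, `t` are
  -- weights for the four corners.
  parallelogram : (v : Fin 4 → Point) → 0# < turn (v 0F) (v 1F) (v 2F) →
    v 3F ≈ₚ v 0F ⊕ (v 2F ⊖ v 1F) → IsParallelogram (ConvexHull v)
  parallelogram v turn₀₁₂ (x₃≈ , y₃≈) = v 0F , v 1F ⊖ v 0F , v 2F ⊖ v 1F ,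
    (λ eq → 0<⇒≉0 turn₀₁₂ (trans (turn-directions (v 0F) (v 1F) (v 2F)) eq)) ,
    (λ {p} → coefficients {p}) , (λ {p} → weights {p})
    where
    Σ₄ : Carrier → Carrier → Carrier → Carrier → Carrier
    Σ₄ a b c d = a + (b + (c + (d + 0#)))

    coefficients : ∀ {p} → ConvexHull v p → ∃₂ λ s t → (0# ≤ s × s ≤ 1#) × (0# ≤ t × t ≤ 1#) ×
      p ≈ₚ v 0F ⊕ s • (v 1F ⊖ v 0F) ⊕ t • (v 2F ⊖ v 1F)
    coefficients (w , 0≤w , Σw≈1 , eq₁ , eq₂) =
      a₁ + a₂ , a₂ + a₃ ,
      (+-nonNeg (0≤w 1F) (0≤w 2F) , ≤-via (+-nonNeg (0≤w 0F) (0≤w 3F)) (trans (+-congʳ (sym Σw≈1))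
        (solve 4 (λ a b c d → a :+ (b :+ (c :+ (d :+ :0))) :- (b :+ c) := a :+ d) refl a₀ a₁ a₂ a₃))) ,
      (+-nonNeg (0≤w 2F) (0≤w 3F) , ≤-via (+-nonNeg (0≤w 0F) (0≤w 1F)) (trans (+-congʳ (sym Σw≈1))
        (solve 4 (λ a b c d → a :+ (b :+ (c :+ (d :+ :0))) :- (c :+ d) := a :+ b) refl a₀ a₁ a₂ a₃))) ,
      coordinate eq₁ x₃≈ , coordinate eq₂ y₃≈
      where
      a₀ = w 0F
      a₁ = w 1F
      a₂ = w 2F
      a₃ = w 3F
      coordinate : ∀ {p x₀ x₁ x₂ x₃} → p ≈ Σ₄ (a₀ * x₀) (a₁ * x₁) (a₂ * x₂) (a₃ * x₃) → x₃ ≈ x₀ + (x₂ - x₁) →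
        p ≈ x₀ + (a₁ + a₂) * (x₁ - x₀) + (a₂ + a₃) * (x₂ - x₁)
      coordinate {p} {x₀} {x₁} {x₂} {x₃} eq x₃≈ = trans eq (trans
        (+-congˡ (+-congˡ (+-congˡ (+-congʳ (*-congˡ x₃≈)))))
        (trans (solve 7 (λ a b c d x y z →
            a :* x :+ (b :* y :+ (c :* z :+ (d :* (x :+ (z :- y)) :+ :0)))
            := (a :+ (b :+ (c :+ (d :+ :0)))) :* x :+ (b :+ c) :* (y :- x) :+ (c :+ d) :* (z :- y)) refl
            a₀ a₁ a₂ a₃ x₀ x₁ x₂)
          (+-congʳ (+-congʳ (trans (*-congʳ Σw≈1) (*-identityˡ x₀))))))

    weights : ∀ {p} → (∃₂ λ s t → (0# ≤ s × s ≤ 1#) × (0# ≤ t × t ≤ 1#) ×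
      p ≈ₚ v 0F ⊕ s • (v 1F ⊖ v 0F) ⊕ t • (v 2F ⊖ v 1F)) → ConvexHull v p
    weights (s , t , (0≤s , s≤1) , (0≤t , t≤1) , eq₁ , eq₂) = w , 0≤w ,
      solve 2 (λ s t → (:1 :- s) :* (:1 :- t) :+ (s :* (:1 :- t) :+ (s :* t :+ ((:1 :- s) :* t :+ :0))) := :1) refl s t ,
      coordinate eq₁ x₃≈ , coordinate eq₂ y₃≈
      where
      w : Fin 4 → Carrier
      w 0F = (1# - s) * (1# - t)
      w 1F = s * (1# - t)
      w 2F = s * t
      w 3F = (1# - s) * t

      0≤w : ∀ i → 0# ≤ w i
      0≤w 0F = *-nonNeg (0≤difference s≤1) (0≤difference t≤1)
      0≤w 1F = *-nonNeg 0≤s (0≤difference t≤1)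
      0≤w 2F = *-nonNeg 0≤s 0≤t
      0≤w 3F = *-nonNeg (0≤difference s≤1) 0≤t

      coordinate : ∀ {p x₀ x₁ x₂ x₃} → p ≈ x₀ + s * (x₁ - x₀) + t * (x₂ - x₁) → x₃ ≈ x₀ + (x₂ - x₁) →
        p ≈ Σ₄ (w 0F * x₀) (w 1F * x₁) (w 2F * x₂) (w 3F * x₃)
      coordinate {p} {x₀} {x₁} {x₂} {x₃} eq x₃≈ = trans eq (trans
        (solve 5 (λ s t x y z → x :+ s :* (y :- x) :+ t :* (z :- y)
          := (:1 :- s) :* (:1 :- t) :* x :+ (s :* (:1 :- t) :* y :+ (s :* t :* z :+ ((:1 :- s) :* t :* (x :+ (z :- y)) :+ :0))))
          refl s t x₀ x₁ x₂)
        (+-congˡ (+-congˡ (+-congˡ (+-congʳ (*-congˡ (sym x₃≈)))))))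

-- Sides of a convex polygon.

module Polygon (em : ExcludedMiddle 0ℓ) (R : RealNumbers) (P : Pred (Plane.Point R) 0ℓ)
  {k : ℕ} (v : Fin (suc k) → Plane.Point R)
  (convex-position : ConvexHulls.ConvexPosition R v) (P≐hull : P ≐ Plane.ConvexHull R v)
  where

  open ConvexHulls R

  P-isConvex : IsConvexSet P
  P-isConvex = record
    { resp   = λ p≈q Pp → proj₂ P≐hull (hull-resp v p≈q (proj₁ P≐hull Pp))
    ; convex = λ Pp Pq 0≤s 0≤t s+t≈1 →
        proj₂ P≐hull (hull-convex v (proj₁ P≐hull Pp) (proj₁ P≐hull Pq) 0≤s 0≤t s+t≈1)
    }

  P-vertex : ∀ i → P (v i)
  P-vertex i = proj₂ P≐hull (hull-vertex v i)

  open Homothets em R P P-isConvex public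

  Supporting : Fin (suc k) → Fin (suc k) → Set
  Supporting i j = ∀ l → 0# ≤ turn (v i) (v j) (v l)

  -- Heights are affine, so both bounds on `P` need checking only at the vertices, and a vertex of
  -- maximal height serves as `far`. The vertex `l` off the line makes that height positive.
  side : ∀ i j l → Supporting i j → 0# < turn (v i) (v j) (v l) → Side
  side i j l supporting 0<turn = build (maximum (λ m → turn (v i) (v j) (v m)))
    where
    build : (∃ λ f → ∀ m → turn (v i) (v j) (v m) ≤ turn (v i) (v j) (v f)) → Side
    build (f , max) = record
      { start = v i
      ; end   = v j
      ; far   = v f
      ; P-start = P-vertex i
      ; P-end   = P-vertex j
      ; P-far   = P-vertex f
      ; height-nonNeg = λ {p} Pp → ≤-respʳ (turn-affine (v i) (v j) p) (hull-half-plane v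
          (i₂ - j₂) (j₁ - i₁) ((j₂ - i₂) * i₁ - (j₁ - i₁) * i₂)
          (λ m → ≤-respʳ (sym (turn-affine (v i) (v j) (v m))) (supporting m)) (proj₁ P≐hull Pp))
      ; height-≤-far = λ {p} Pp → ≤-via (hull-half-plane v
          (- (i₂ - j₂)) (- (j₁ - i₁)) (turn (v i) (v j) (v f) - ((j₂ - i₂) * i₁ - (j₁ - i₁) * i₂))
          (λ m → ≤-respʳ (complement (v m)) (0≤difference (max m))) (proj₁ P≐hull Pp))
          (complement p)
      ; height-far = <-≤-trans 0<turn (max l)
      }
      where
      i₁ = proj₁ (v i)
      i₂ = proj₂ (v i)
      j₁ = proj₁ (v j)
      j₂ = proj₂ (v j)
      complement : ∀ p → turn (v i) (v j) (v f) - turn (v i) (v j) p ≈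
        - (i₂ - j₂) * proj₁ p + - (j₁ - i₁) * proj₂ p + (turn (v i) (v j) (v f) - ((j₂ - i₂) * i₁ - (j₁ - i₁) * i₂))
      complement p = trans (+-congˡ (-‿cong (sym (turn-affine (v i) (v j) p))))
        (solve 6 (λ T a b c x y → T :- (a :* x :+ b :* y :+ c) := :- a :* x :+ :- b :* y :+ (T :- c)) refl
          (turn (v i) (v j) (v f)) (i₂ - j₂) (j₁ - i₁) ((j₂ - i₂) * i₁ - (j₁ - i₁) * i₂) (proj₁ p) (proj₂ p))


  -- No index lies strictly between `i` and `j`, so any other vertex comes before or after both and
  -- forms an increasing triple with them up to rotation.
  consecutive : ∀ i j → toℕ j ≡ suc (toℕ i) → Supporting i j
  consecutive i j j≡1+i l with Fin.<-cmp l i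
  ... | tri< l<i _ _ = ≤-respʳ (turn-rotate (v l) (v i) (v j))
          (<⇒≤ (convex-position l i j l<i (ℕ.≤-reflexive (≡.sym j≡1+i))))
  ... | tri≈ _ ≡.refl _ = ≤-reflexive (sym (turn-start (v i) (v j)))
  ... | tri> _ _ i<l with Fin.<-cmp j l
  ...   | tri< j<l _ _ = <⇒≤ (convex-position i j l (ℕ.≤-reflexive (≡.sym j≡1+i)) j<l)
  ...   | tri≈ _ ≡.refl _ = ≤-reflexive (sym (turn-end (v i) (v j)))
  ...   | tri> _ _ l<j = contradiction (ℕ.<-≤-trans l<j (≡.subst (ℕ._≤ toℕ l) (≡.sym j≡1+i) i<l)) (ℕ.<-irrefl ≡.refl)

  closing : Supporting (fromℕ k) zero
  closing zero = ≤-reflexive (sym (turn-end (v (fromℕ k)) (v zero)))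
  closing (suc l) with Fin.<-cmp (suc l) (fromℕ k)
  ... | tri< l<k _ _ = ≤-respʳ (trans (turn-rotate (v zero) (v (suc l)) (v (fromℕ k))) (turn-rotate (v (suc l)) (v (fromℕ k)) (v zero)))
          (<⇒≤ (convex-position zero (suc l) (fromℕ k) (s≤s z≤n) l<k))
  ... | tri≈ _ eq _ = ≤-reflexive (sym (trans (reflexive (≡.cong (λ m → turn (v (fromℕ k)) (v zero) (v m)) eq)) (turn-start (v (fromℕ k)) (v zero))))
  ... | tri> _ _ k<l = contradiction (ℕ.<-≤-trans k<l (Fin.≤fromℕ (suc l))) (ℕ.<-irrefl ≡.refl)

  three-sides : (S₀ S₁ S₂ : Side) → let open Side in
    ¬ cross (direction S₀) (direction S₁) ≈ 0# →
    ¬ cross (direction S₀) (direction S₂) ≈ 0# →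
    ¬ cross (direction S₁) (direction S₂) ≈ 0# →
    Σ[ f ∈ (ℕ → ℕ) ] (∀ n → IsMaximumMaximalCliques (Hom P) n (f n)) × f ∈Ω (λ n → n ^ 3)
  three-sides S₀ S₁ S₂ n₀₁ n₀₂ n₁₂ = maximum-cubic S nonparallel
    where
    S : Fin 3 → Side
    S 0F = S₀
    S 1F = S₁
    S 2F = S₂

    swap : ∀ {u v} → ¬ cross u v ≈ 0# → ¬ cross v u ≈ 0#
    swap {u} {v} uv≉0 vu≈0 = uv≉0 (trans (cross-swap u v) (trans (-‿cong vu≈0) (solve 0 (:- :0 := :0) refl)))

    nonparallel : ∀ d e → d ≢ e → ¬ cross (Side.direction (S d)) (Side.direction (S e)) ≈ 0#
    nonparallel 0F 0F d≢e = contradiction ≡.refl d≢e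
    nonparallel 0F 1F _   = n₀₁
    nonparallel 0F 2F _   = n₀₂
    nonparallel 1F 0F _   = swap {Side.direction S₀} {Side.direction S₁} n₀₁
    nonparallel 1F 1F d≢e = contradiction ≡.refl d≢e
    nonparallel 1F 2F _   = n₁₂
    nonparallel 2F 0F _   = swap {Side.direction S₀} {Side.direction S₂} n₀₂
    nonparallel 2F 1F _   = swap {Side.direction S₁} {Side.direction S₂} n₁₂
    nonparallel 2F 2F d≢e = contradiction ≡.refl d≢e

-- Three pairwise nonparallel sides.

module NonParallelogram (em : ExcludedMiddle 0ℓ) (R : RealNumbers) (P : Pred (Plane.Point R) 0ℓ)
  (¬parallelogram : ¬ Plane.IsParallelogram R P)
  where

  open ConvexHulls R

  Conclusion : Set
  Conclusion = Σ[ f ∈ (ℕ → ℕ) ] (∀ n → IsMaximumMaximalCliques (Hom P) n (f n)) × f ∈Ω (λ n → n ^ 3)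

  consecutive-≉0 : ∀ p q r → 0# < turn p q r → ¬ cross (q ⊖ p) (r ⊖ q) ≈ 0#
  consecutive-≉0 p q r 0<turn = 0<⇒≉0 (0<-resp (turn-directions p q r) 0<turn)

  closing-≉0 : ∀ p q r → 0# < turn p q r → ¬ cross (q ⊖ p) (p ⊖ r) ≈ 0#
  closing-≉0 p q r 0<turn eq = 0<⇒≉0 0<turn (trans (negate p q r)
    (trans (-‿cong eq) (solve 0 (:- :0 := :0) refl)))
    where
    negate : ∀ p q r → turn p q r ≈ - cross (q ⊖ p) (p ⊖ r)
    negate (p₁ , p₂) (q₁ , q₂) (r₁ , r₂) = solve 6 (λ p₁ p₂ q₁ q₂ r₁ r₂ →
      (q₁ :- p₁) :* (r₂ :- p₂) :- (q₂ :- p₂) :* (r₁ :- p₁) :=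
      :- ((q₁ :- p₁) :* (p₂ :- r₂) :- (q₂ :- p₂) :* (p₁ :- r₁))) refl p₁ p₂ q₁ q₂ r₁ r₂

  triangle : (v : Fin 3 → Point) → ConvexPosition v → P ≐ ConvexHull v → Conclusion
  triangle v convex-position P≐hull = three-sides
    (side 0F 1F 2F (consecutive 0F 1F ≡.refl) t₀₁₂)
    (side 1F 2F 0F (consecutive 1F 2F ≡.refl) t₁₂₀)
    (side 2F 0F 1F closing (0<-resp (turn-rotate (v 1F) (v 2F) (v 0F)) t₁₂₀))
    (consecutive-≉0 (v 0F) (v 1F) (v 2F) t₀₁₂)
    (closing-≉0 (v 0F) (v 1F) (v 2F) t₀₁₂)
    (consecutive-≉0 (v 1F) (v 2F) (v 0F) t₁₂₀)
    where
    open Polygon em R P v convex-position P≐hull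
    t₀₁₂ = convex-position 0F 1F 2F (s≤s z≤n) (s≤s (s≤s z≤n))
    t₁₂₀ = 0<-resp (turn-rotate (v 0F) (v 1F) (v 2F)) t₀₁₂

  -- Let `D` be `d` minus the claimed value. Then `d - c` is `D - (b - a)` and `a - d` is
  -- `- D - (c - b)`, so both hypotheses say that `D` is parallel to one of the independent vectors
  -- `b - a` and `c - b`; Cramer's rule gives `D = 0`.
  fourth-vertex : ∀ (a b c d : Point) → 0# < turn a b c →
    cross (b ⊖ a) (d ⊖ c) ≈ 0# → cross (c ⊖ b) (a ⊖ d) ≈ 0# → d ≈ₚ a ⊕ (c ⊖ b)
  fourth-vertex (a₁ , a₂) (b₁ , b₂) (c₁ , c₂) (d₁ , d₂) 0<turn ab∥cd bc∥da =
    difference-zero (*-cancelˡ-0 (0<⇒≉0 0<turn) (trans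
      (solve 8 (λ a₁ a₂ b₁ b₂ c₁ c₂ d₁ d₂ →
        ((b₁ :- a₁) :* (c₂ :- a₂) :- (b₂ :- a₂) :* (c₁ :- a₁)) :* (d₁ :- (a₁ :+ (c₁ :- b₁))) :=
        ((b₁ :- a₁) :* (d₂ :- c₂) :- (b₂ :- a₂) :* (d₁ :- c₁)) :* (c₁ :- b₁) :+
        ((c₁ :- b₁) :* (a₂ :- d₂) :- (c₂ :- b₂) :* (a₁ :- d₁)) :* (b₁ :- a₁)) refl
        a₁ a₂ b₁ b₂ c₁ c₂ d₁ d₂)
      (vanish ab∥cd bc∥da))) ,
    difference-zero (*-cancelˡ-0 (0<⇒≉0 0<turn) (trans
      (solve 8 (λ a₁ a₂ b₁ b₂ c₁ c₂ d₁ d₂ →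
        ((b₁ :- a₁) :* (c₂ :- a₂) :- (b₂ :- a₂) :* (c₁ :- a₁)) :* (d₂ :- (a₂ :+ (c₂ :- b₂))) :=
        ((b₁ :- a₁) :* (d₂ :- c₂) :- (b₂ :- a₂) :* (d₁ :- c₁)) :* (c₂ :- b₂) :+
        ((c₁ :- b₁) :* (a₂ :- d₂) :- (c₂ :- b₂) :* (a₁ :- d₁)) :* (b₂ :- a₂)) refl
        a₁ a₂ b₁ b₂ c₁ c₂ d₁ d₂)
      (vanish ab∥cd bc∥da)))
    where
    vanish : ∀ {x y s t} → x ≈ 0# → y ≈ 0# → x * s + y * t ≈ 0#
    vanish {s = s} {t} x≈0 y≈0 = trans (+-cong (*-congʳ x≈0) (*-congʳ y≈0))
      (solve 2 (λ s t → :0 :* s :+ :0 :* t := :0) refl s t)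
    difference-zero : ∀ {x y} → x - y ≈ 0# → x ≈ y
    difference-zero {x} {y} eq = trans (solve 2 (λ x y → x := x :- y :+ y) refl x y)
      (trans (+-congʳ eq) (+-identityˡ y))

  -- Adjacent sides are never parallel, so one nonparallel pair of opposite sides yields a triple
  -- together with a side adjacent to both. If both pairs are parallel, the polygon is a
  -- parallelogram.
  quadrilateral : (v : Fin 4 → Point) → ConvexPosition v → P ≐ ConvexHull v → Conclusion
  quadrilateral v convex-position P≐hull = decide em em
    where
    open Polygon em R P v convex-position P≐hull
    t₀₁₂ = convex-position 0F 1F 2F (s≤s z≤n) (s≤s (s≤s z≤n))
    t₀₁₃ = convex-position 0F 1F 3F (s≤s z≤n) (s≤s (s≤s z≤n))
    t₀₂₃ = convex-position 0F 2F 3F (s≤s z≤n) (s≤s (s≤s (s≤s z≤n)))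
    t₁₂₃ = convex-position 1F 2F 3F (s≤s (s≤s z≤n)) (s≤s (s≤s (s≤s z≤n)))
    t₁₂₀ = 0<-resp (turn-rotate (v 0F) (v 1F) (v 2F)) t₀₁₂
    t₂₃₀ = 0<-resp (turn-rotate (v 0F) (v 2F) (v 3F)) t₀₂₃
    t₃₀₁ = 0<-resp (trans (turn-rotate (v 0F) (v 1F) (v 3F)) (turn-rotate (v 1F) (v 3F) (v 0F))) t₀₁₃

    S₀₁ = side 0F 1F 2F (consecutive 0F 1F ≡.refl) t₀₁₂
    S₁₂ = side 1F 2F 0F (consecutive 1F 2F ≡.refl) t₁₂₀
    S₂₃ = side 2F 3F 0F (consecutive 2F 3F ≡.refl) t₂₃₀
    S₃₀ = side 3F 0F 1F closing t₃₀₁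

    decide : Dec (cross (v 1F ⊖ v 0F) (v 3F ⊖ v 2F) ≈ 0#) → Dec (cross (v 2F ⊖ v 1F) (v 0F ⊖ v 3F) ≈ 0#) → Conclusion
    decide _ (no n₁₂,₃₀) = three-sides S₀₁ S₁₂ S₃₀
      (consecutive-≉0 (v 0F) (v 1F) (v 2F) t₀₁₂) (closing-≉0 (v 0F) (v 1F) (v 3F) t₀₁₃) n₁₂,₃₀
    decide (no n₀₁,₂₃) _ = three-sides S₀₁ S₁₂ S₂₃
      (consecutive-≉0 (v 0F) (v 1F) (v 2F) t₀₁₂) n₀₁,₂₃ (consecutive-≉0 (v 1F) (v 2F) (v 3F) t₁₂₃)
    decide (yes p₀₁,₂₃) (yes p₁₂,₃₀) = contradiction
      (≐-parallelogram (parallelogram v t₀₁₂ (fourth-vertex (v 0F) (v 1F) (v 2F) (v 3F) t₀₁₂ p₀₁,₂₃ p₁₂,₃₀)))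
      ¬parallelogram
      where
      ≐-parallelogram : IsParallelogram (ConvexHull v) → IsParallelogram P
      ≐-parallelogram (a , u , w , uw≉0 , hull⊆ , ⊆hull) =
        a , u , w , uw≉0 , (λ p∈P → hull⊆ (proj₁ P≐hull p∈P)) , (λ q → proj₂ P≐hull (⊆hull q))

  -- From five vertices on, the sides into `v 0F`, from `v 1F` to `v 2F` and from `v 3F` to `v 4F`
  -- are three different sides, and these cannot all be parallel. The middle one, an outer one not
  -- parallel to it, and the side between these two form the triple.
  many-vertices : ∀ {k} (v : Fin (5 ℕ.+ k) → Point) → ConvexPosition v → P ≐ ConvexHull v → Conclusion
  many-vertices {k} v convex-position P≐hull = decide em em
    where
    open Polygon em R P v convex-position P≐hull
    last : Fin (5 ℕ.+ k)
    last = fromℕ (4 ℕ.+ k)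
    t₀₁₂ = convex-position 0F 1F 2F (s≤s z≤n) (s≤s (s≤s z≤n))
    t₀₂₃ = convex-position 0F 2F 3F (s≤s z≤n) (s≤s (s≤s (s≤s z≤n)))
    t₀₃₄ = convex-position 0F 3F 4F (s≤s z≤n) (s≤s (s≤s (s≤s (s≤s z≤n))))
    t₁₂₃ = convex-position 1F 2F 3F (s≤s (s≤s z≤n)) (s≤s (s≤s (s≤s z≤n)))
    t₂₃₄ = convex-position 2F 3F 4F (s≤s (s≤s (s≤s z≤n))) (s≤s (s≤s (s≤s (s≤s z≤n))))
    t₀₁ₗ = convex-position 0F 1F last (s≤s z≤n) (s≤s (s≤s z≤n))
    t₀₃ₗ = convex-position 0F 3F last (s≤s z≤n) (s≤s (s≤s (s≤s (s≤s z≤n))))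

    S₀₁ = side 0F 1F 2F (consecutive 0F 1F ≡.refl) t₀₁₂
    S₁₂ = side 1F 2F 0F (consecutive 1F 2F ≡.refl) (0<-resp (turn-rotate (v 0F) (v 1F) (v 2F)) t₀₁₂)
    S₂₃ = side 2F 3F 0F (consecutive 2F 3F ≡.refl) (0<-resp (turn-rotate (v 0F) (v 2F) (v 3F)) t₀₂₃)
    S₃₄ = side 3F 4F 0F (consecutive 3F 4F ≡.refl) (0<-resp (turn-rotate (v 0F) (v 3F) (v 4F)) t₀₃₄)
    Sₗ₀ = side last 0F 1F closing
      (0<-resp (trans (turn-rotate (v 0F) (v 1F) (v last)) (turn-rotate (v 1F) (v last) (v 0F))) t₀₁ₗ)

    e₀₁ = v 1F ⊖ v 0F
    e₁₂ = v 2F ⊖ v 1F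
    e₂₃ = v 3F ⊖ v 2F
    e₃₄ = v 4F ⊖ v 3F
    eₗ₀ = v 0F ⊖ v last

    -- Otherwise expanding turns of the polygon by cross-parallel, in the basis
    -- e₀₁, e₁₂, makes the polygon turn to the right at v 2F.
    no-three-parallel : cross e₁₂ eₗ₀ ≈ 0# → ¬ cross e₁₂ e₃₄ ≈ 0#
    no-three-parallel p₁₂,ₗ₀ p₁₂,₃₄ = <⇒≱ 0<cross₂₃,₁₂ (≤-via (<⇒≤ 0<cross₁₂,₂₃)
      (trans (solve 1 (λ x → :0 :- x := :- x) refl (cross e₂₃ e₁₂)) (sym (cross-swap e₁₂ e₂₃))))
      where
      w = v 3F ⊖ v 0F
      l = v last ⊖ v 0F

      0<cross₀₁,₁₂ : 0# < cross e₀₁ e₁₂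
      0<cross₀₁,₁₂ = 0<-resp (turn-directions (v 0F) (v 1F) (v 2F)) t₀₁₂

      0<cross₁₂,₂₃ : 0# < cross e₁₂ e₂₃
      0<cross₁₂,₂₃ = 0<-resp (turn-directions (v 1F) (v 2F) (v 3F)) t₁₂₃

      l∥e₁₂ : cross l e₁₂ ≈ 0#
      l∥e₁₂ = trans (reverse (v last) (v 0F) e₁₂) p₁₂,ₗ₀
        where
        reverse : ∀ p q u → cross (p ⊖ q) u ≈ cross u (q ⊖ p)
        reverse (p₁ , p₂) (q₁ , q₂) (u₁ , u₂) = solve 6 (λ p₁ p₂ q₁ q₂ u₁ u₂ →
          (p₁ :- q₁) :* u₂ :- (p₂ :- q₂) :* u₁ := u₁ :* (q₂ :- p₂) :- u₂ :* (q₁ :- p₁)) refl p₁ p₂ q₁ q₂ u₁ u₂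

      e₃₄∥e₁₂ : cross e₃₄ e₁₂ ≈ 0#
      e₃₄∥e₁₂ = trans (cross-swap e₃₄ e₁₂) (trans (-‿cong p₁₂,₃₄) (solve 0 (:- :0 := :0) refl))

      -- Here and in the next two steps three factors of the relation are known to be positive, from
      -- turns of the polygon or from earlier steps, which forces the sign of the fourth.
      0<cross-w,₁₂ : 0# < cross w e₁₂
      0<cross-w,₁₂ = *-cancelˡ-pos t₀₁ₗ (0<-resp
        (trans (cross-parallel e₀₁ e₁₂ w l l∥e₁₂) (*-comm (cross w e₁₂) (cross e₀₁ l)))
        (*-pos 0<cross₀₁,₁₂ t₀₃ₗ))

      0<cross₀₁,₃₄ : 0# < cross e₀₁ e₃₄
      0<cross₀₁,₃₄ = *-cancelˡ-pos 0<cross-w,₁₂ (0<-resp (cross-parallel e₀₁ e₁₂ w e₃₄ e₃₄∥e₁₂)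
        (*-pos 0<cross₀₁,₁₂ (0<-resp (turn-directions (v 0F) (v 3F) (v 4F)) t₀₃₄)))

      0<cross₂₃,₁₂ : 0# < cross e₂₃ e₁₂
      0<cross₂₃,₁₂ = *-cancelˡ-pos 0<cross₀₁,₃₄ (0<-resp
        (trans (cross-parallel e₀₁ e₁₂ e₂₃ e₃₄ e₃₄∥e₁₂) (*-comm (cross e₂₃ e₁₂) (cross e₀₁ e₃₄)))
        (*-pos 0<cross₀₁,₁₂ (0<-resp (turn-directions (v 2F) (v 3F) (v 4F)) t₂₃₄)))

    decide : Dec (cross e₁₂ eₗ₀ ≈ 0#) → Dec (cross e₁₂ e₃₄ ≈ 0#) → Conclusion
    decide (no n₁₂,ₗ₀) _ = three-sides S₀₁ S₁₂ Sₗ₀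
      (consecutive-≉0 (v 0F) (v 1F) (v 2F) t₀₁₂) (closing-≉0 (v 0F) (v 1F) (v last) t₀₁ₗ) n₁₂,ₗ₀
    decide (yes _) (no n₁₂,₃₄) = three-sides S₁₂ S₂₃ S₃₄
      (consecutive-≉0 (v 1F) (v 2F) (v 3F) t₁₂₃) n₁₂,₃₄ (consecutive-≉0 (v 2F) (v 3F) (v 4F) t₂₃₄)
    decide (yes p₁₂,ₗ₀) (yes p₁₂,₃₄) = contradiction p₁₂,₃₄ (no-three-parallel p₁₂,ₗ₀)

theorem7 : ExcludedMiddle 0ℓ → (R : RealNumbers) → let open Plane R in
    (P : Pred Point 0ℓ) → IsConvexPolygon P → ¬ IsParallelogram P →
    Σ[ f ∈ (ℕ → ℕ) ] (∀ n → IsMaximumMaximalCliques (Hom P) n (f n)) ×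
    f ∈Ω (λ n → n ^ 3)
theorem7 em R P (0 , _ , () , _) _
theorem7 em R P (1 , _ , s≤s () , _) _
theorem7 em R P (2 , _ , s≤s (s≤s ()) , _) _
theorem7 em R P (3 , v , _ , convex-position , P≐hull) ¬parallelogram =
  NonParallelogram.triangle em R P ¬parallelogram v convex-position P≐hull
theorem7 em R P (4 , v , _ , convex-position , P≐hull) ¬parallelogram =
  NonParallelogram.quadrilateral em R P ¬parallelogram v convex-position P≐hull
theorem7 em R P (suc (suc (suc (suc (suc k)))) , v , _ , convex-position , P≐hull) ¬parallelogram =
  NonParallelogram.many-vertices em R P ¬parallelogram v convex-position P≐hull
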